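{- For integers $n,k$ with $n\ge 2$ and $1\le k<2^{n-1}$, the number $\sigma_{n,k}$ of separating families of $k$ proper bipartitions over an $n$-element set is $$\sigma_{n,k}=\frac{(n-1)!}{k!}\sum_{i=1}^{k}(-1)^{k-i}\left[{k+1 \atop i+1}\right]\binom{2^i-1}{n-1}.$$
   Context: A bipartition of a set $S$ is a partition of $S$ into at most two nonempty components; it is proper if it has exactly two components. A bipartition cuts two elements if they lie in different components. A family of bipartitions of $S$ is a separating family for $S$ if every two distinct elements of $S$ are cut by some bipartition in the family. $\sigma_{n,k}$ is the number of separating families consisting of $k$ distinct proper bipartitions of a fixed $n$-element set. $\left[{a \atop b}\right]$ denotes the unsigned Stirling number of the first kind (number of permutations of $a$ elements with exactly $b$ cycles). -}

module Defs where

open import Data.Bool using (Bool; true; false; _∧_; _∨_; not; if_then_else_)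
open import Data.Nat using (ℕ; zero; suc; _+_; _*_; _∸_; _^_; _≡ᵇ_)
open import Data.Fin using (Fin)
import Data.Fin as Fin
open import Data.Vec using (Vec; []; _∷_; lookup)
import Data.Vec as Vec
open import Data.List using (List; allFin; filterᵇ; length)
open import Data.Bool.ListAction using (all; any)
import Data.List as List
open import Data.Integer using (ℤ; +_; -_)
import Data.Integer as ℤ
open import Relation.Nullary.Decidable using (⌊_⌋)

-- A subset of Fin n, as its characteristic vector.
Sub : ℕ → Set
Sub n = Vec Bool n

subsets : (n : ℕ) → Vec (Sub n) (2 ^ n)
subsets zero = [] ∷ []
subsets (suc n) =
  Vec._++_ (Vec.map (true ∷_) (subsets n)) (Vec._++_ (Vec.map (false ∷_) (subsets n)) [])

allF : (m : ℕ) → (Fin m → Bool) → Bool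
allF m p = all p (allFin m)

anyF : (m : ℕ) → (Fin m → Bool) → Bool
anyF m p = any p (allFin m)

countF : (m : ℕ) → (Fin m → Bool) → ℕ
countF m p = length (filterᵇ p (allFin m))

_∈ᵇ_ : {n : ℕ} → Fin n → Sub n → Bool
i ∈ᵇ A = lookup A i

nonemptyᵇ : {n : ℕ} → Sub n → Bool
nonemptyᵇ {n} A = anyF n (λ i → i ∈ᵇ A)

-- A family (set) of subsets of Fin n: characteristic vector over the enumeration.
Coll : ℕ → Set
Coll n = Vec Bool (2 ^ n)

inCollᵇ : {n : ℕ} → Fin (2 ^ n) → Coll n → Bool
inCollᵇ {n} j C = lookup C j

blk : {n : ℕ} → Fin (2 ^ n) → Sub n
blk {n} j = lookup (subsets n) j

numBlocks : {n : ℕ} → Coll n → ℕ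
numBlocks {n} C = countF (2 ^ n) (λ j → inCollᵇ {n} j C)

isPartitionᵇ : {n : ℕ} → Coll n → Bool
isPartitionᵇ {n} C =
  allF (2 ^ n) (λ j → not (inCollᵇ {n} j C) ∨ nonemptyᵇ (blk {n} j))
  ∧ allF n (λ i → countF (2 ^ n) (λ j → inCollᵇ {n} j C ∧ (i ∈ᵇ blk {n} j)) ≡ᵇ 1)

isBipartitionᵇ : {n : ℕ} → Coll n → Bool
isBipartitionᵇ {n} C = isPartitionᵇ {n} C ∧ (numBlocks {n} C Data.Nat.≤ᵇ 2)

isProperBipartitionᵇ : {n : ℕ} → Coll n → Bool
isProperBipartitionᵇ {n} C = isPartitionᵇ {n} C ∧ (numBlocks {n} C ≡ᵇ 2)

-- C cuts a and b: they lie in different components, i.e. some component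
-- contains a but not b (for a partition).
cutsᵇ : {n : ℕ} → Coll n → Fin n → Fin n → Bool
cutsᵇ {n} C a b =
  anyF (2 ^ n) (λ j → inCollᵇ {n} j C ∧ (a ∈ᵇ blk {n} j) ∧ not (b ∈ᵇ blk {n} j))

-- A set of bipartitions-candidates: a set of collections, characteristic
-- vector over all collections (indexed via the enumeration subsets (2 ^ n)).
Family : ℕ → Set
Family n = Vec Bool (2 ^ (2 ^ n))

coll : {n : ℕ} → Fin (2 ^ (2 ^ n)) → Coll n
coll {n} t = lookup (subsets (2 ^ n)) t

inFamᵇ : {n : ℕ} → Fin (2 ^ (2 ^ n)) → Family n → Bool
inFamᵇ {n} t F = lookup F t

famSize : {n : ℕ} → Family n → ℕ
famSize {n} F = countF (2 ^ (2 ^ n)) (λ t → inFamᵇ {n} t F)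

separatingᵇ : {n : ℕ} → Family n → Bool
separatingᵇ {n} F =
  allF n (λ a → allF n (λ b →
    ⌊ a Fin.≟ b ⌋ ∨ anyF (2 ^ (2 ^ n)) (λ t → inFamᵇ {n} t F ∧ cutsᵇ {n} (coll {n} t) a b)))

goodFamᵇ : {n : ℕ} → ℕ → Family n → Bool
goodFamᵇ {n} k F =
  allF (2 ^ (2 ^ n)) (λ t → not (inFamᵇ {n} t F) ∨ isProperBipartitionᵇ {n} (coll {n} t))
  ∧ (famSize {n} F ≡ᵇ k) ∧ separatingᵇ {n} F

σ : ℕ → ℕ → ℕ
σ n k = countF (2 ^ (2 ^ (2 ^ n))) (λ u → goodFamᵇ {n} k (lookup (subsets (2 ^ (2 ^ n))) u))

stirling1 : ℕ → ℕ → ℕ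
stirling1 zero zero = 1
stirling1 zero (suc b) = 0
stirling1 (suc a) zero = 0
stirling1 (suc a) (suc b) = a * stirling1 a (suc b) + stirling1 a b

signℤ : ℕ → ℤ
signℤ zero = + 1
signℤ (suc m) = - signℤ m

sumFrom1 : ℕ → (ℕ → ℤ) → ℤ
sumFrom1 zero f = + 0
sumFrom1 (suc k) f = sumFrom1 k f ℤ.+ f (suc k)

{-# OPTIONS --safe #-}
module Submission where

-- For a weight φ on families, let S_k φ be the sum of φ F over the k-element families F of
-- proper bipartitions, and let E φ (F) be the sum of φ (F ∪ {x}) over all bipartitions x, where
-- adjoining the trivial one changes nothing. Distinguishing whether x already belongs to F gives
-- S_k (E φ) = (k+1) (S_k φ + S_{k+1} φ), so h k i = k! S_k (E^i φ) satisfies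
-- h (k+1) i = h k (i+1) - (k+1) h k i, that is, h k 0 is obtained from the polynomial
-- (x-1)(x-2)⋯(x-k), whose coefficients are signed Stirling numbers, by replacing x^i with h 0 i.
-- If φ indicates separation, h 0 i = E^i φ (∅) counts the binary matrices with i rows and n-1
-- distinct nonzero columns: a bipartition is a row recording which elements are cut from a fixed
-- one. Hence h 0 i = (n-1)! C(2^i - 1, n-1), and it vanishes for i = 0.

open import Defs
open import Data.Bool using (Bool; true; false; _∧_; _∨_; not; _xor_; T)
open import Data.Bool.ListAction using (and; or)
open import Data.Bool.Properties
  using (T?; T-∧; T-∨; T-not-≡; ∧-assoc; ∧-zeroʳ; ∨-assoc; ∨-identityʳ; xor-comm; xor-same)
open import Data.Empty using (⊥; ⊥-elim)
open import Data.Fin using (Fin; zero; suc)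
import Data.Fin as Fin
import Data.Fin.Properties as Fin
import Data.Integer as ℤ
import Data.Integer.Properties as ℤ
import Data.Integer.Tactic.RingSolver as ℤ
open import Data.List using (List; []; _∷_; _++_; map; length; filterᵇ; allFin)
open import Data.List.Membership.Propositional using (_∈_; lose; find)
open import Data.List.Membership.Propositional.Properties
  using (∈-allFin; ∈-filter⁺; ∈-filter⁻; ∈-map⁺; ∈-map⁻; ∈-++⁺ˡ; ∈-++⁺ʳ)
open import Data.List.Membership.Propositional.Properties.WithK using (unique∧set⇒bag)
open import Data.List.Properties using (map-++; map-∘; map-cong; map-tabulate; ++-identityʳ)
open import Data.List.Relation.Binary.BagAndSetEquality using (∼bag⇒↭)
open import Data.List.Relation.Binary.Permutation.Propositional using (_↭_)
import Data.List.Relation.Binary.Permutation.Propositional.Properties as Permutation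
import Data.List.Relation.Unary.All as All
import Data.List.Relation.Unary.All.Properties as All
open import Data.List.Relation.Unary.AllPairs using ([]; _∷_)
open import Data.List.Relation.Unary.Any using (here; there)
import Data.List.Relation.Unary.Any.Properties as Any
open import Data.List.Relation.Unary.Unique.Propositional using (Unique)
import Data.List.Relation.Unary.Unique.Propositional.Properties as Unique
open import Data.Nat using (ℕ; zero; suc; _≤_; _<_; z≤n; s≤s; _∸_; _^_; _!; _≡ᵇ_)
import Data.Nat as ℕ
open import Data.Nat.Combinatorics using (_C_; nCk+nC[k+1]≡[n+1]C[k+1]; nC1≡n; k>n⇒nCk≡0)
open import Data.Nat.ListAction using (sum)
open import Data.Nat.ListAction.Properties using (sum-++; sum-↭)
open import Data.Nat.Properties hiding (suc-injective)
open import Data.Nat.Tactic.RingSolver using (solve-∀)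
open import Data.Product using (_×_; _,_; proj₁; proj₂; ∃-syntax; ∃₂)
open import Data.Sum using (_⊎_; inj₁; inj₂)
import Data.Sum as Sum
open import Data.Unit using (tt)
open import Data.Vec using (Vec; []; _∷_; lookup; replicate; tabulate; toList; zipWith; _[_]≔_)
import Data.Vec as Vec
import Data.Vec.Membership.Propositional.Properties as Vec
open import Data.Vec.Properties
  using (lookup-map; lookup-replicate; lookup-zipWith; lookup∘tabulate; tabulate∘lookup; tabulate-cong;
         toList-++; toList-map; ∷-injectiveʳ)
open import Function using (_∘_; id; Equivalence; _⇔_; mk⇔)
open import Relation.Binary.PropositionalEquality
  using (_≡_; _≢_; refl; sym; trans; cong; cong₂; subst; module ≡-Reasoning)
open import Relation.Nullary using (yes; no; ¬_; contradiction)
open import Relation.Nullary.Decidable using (⌊_⌋)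

-- The same device produces the shift in the Stirling numbers: the `k` members of a family together
-- with the trivial bipartition are the `k + 1` choices that leave the family unchanged. So the
-- roots are `1, ..., k` instead of `0, ..., k - 1`, and the coefficients are those of
-- `x(x - 1)⋯(x - k)` divided by `x`. A family is a characteristic vector over all collections of
-- subsets, on which iterating the operator directly would be unwieldy. Whether it separates depends
-- only on the pairs it cuts, so the weights used are functions of the cut relation, and adjoining a
-- bipartition becomes a union of relations. The encoding of a bipartition as a collection is
-- unpacked only for the bijection of proper bipartitions with nonzero bit vectors.

module Counting where

  open import Data.Nat using (_+_; _*_)
  open import Algebra.Properties.CommutativeSemigroup *-commutativeSemigroup using (x∙yz≈y∙xz; x∙yz≈yx∙z)
  open Equivalence using (to; from)

  -- Finite sums and indicators

  ∑ : {A : Set} → List A → (A → ℕ) → ℕ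
  ∑ xs f = sum (map f xs)

  𝟙 : Bool → ℕ
  𝟙 true  = 1
  𝟙 false = 0

  𝟙-∧ : ∀ a b → 𝟙 (a ∧ b) ≡ 𝟙 a * 𝟙 b
  𝟙-∧ true  b = sym (+-identityʳ (𝟙 b))
  𝟙-∧ false b = refl

  ∑-cong : {A : Set} {f g : A → ℕ} → (∀ x → f x ≡ g x) → ∀ xs → ∑ xs f ≡ ∑ xs g
  ∑-cong h xs = cong sum (map-cong h xs)

  ∑-zero : {A : Set} (xs : List A) → ∑ xs (λ _ → 0) ≡ 0
  ∑-zero []       = refl
  ∑-zero (_ ∷ xs) = ∑-zero xs

  ∑-distrib-+ : {A : Set} (f g : A → ℕ) → ∀ xs → ∑ xs (λ x → f x + g x) ≡ ∑ xs f + ∑ xs g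
  ∑-distrib-+ f g []       = refl
  ∑-distrib-+ f g (x ∷ xs) =
    trans (cong (f x + g x +_) (∑-distrib-+ f g xs)) (interchange (f x) (g x) (∑ xs f) (∑ xs g))
    where
    interchange : ∀ a b c d → a + b + (c + d) ≡ a + c + (b + d)
    interchange = solve-∀

  *-distribˡ-∑ : {A : Set} (c : ℕ) (f : A → ℕ) → ∀ xs → ∑ xs (λ x → c * f x) ≡ c * ∑ xs f
  *-distribˡ-∑ c f []       = sym (*-zeroʳ c)
  *-distribˡ-∑ c f (x ∷ xs) =
    trans (cong (c * f x +_) (*-distribˡ-∑ c f xs)) (sym (*-distribˡ-+ c (f x) (∑ xs f)))

  *-distribʳ-∑ : {A : Set} (c : ℕ) (f : A → ℕ) → ∀ xs → ∑ xs (λ x → f x * c) ≡ ∑ xs f * c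
  *-distribʳ-∑ c f xs =
    trans (∑-cong (λ x → *-comm (f x) c) xs) (trans (*-distribˡ-∑ c f xs) (*-comm c (∑ xs f)))

  ∑-swap : {A B : Set} (f : A → B → ℕ) → ∀ xs ys →
    ∑ xs (λ x → ∑ ys (f x)) ≡ ∑ ys (λ y → ∑ xs (λ x → f x y))
  ∑-swap f []       ys = sym (∑-zero ys)
  ∑-swap f (x ∷ xs) ys =
    trans (cong (∑ ys (f x) +_) (∑-swap f xs ys)) (sym (∑-distrib-+ (f x) (λ y → ∑ xs (λ x → f x y)) ys))

  ∑-++ : {A : Set} (f : A → ℕ) → ∀ xs ys → ∑ (xs ++ ys) f ≡ ∑ xs f + ∑ ys f
  ∑-++ f xs ys = trans (cong sum (map-++ f xs ys)) (sum-++ (map f xs) (map f ys))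

  ∑-map : {A B : Set} (f : B → ℕ) (g : A → B) → ∀ xs → ∑ (map g xs) f ≡ ∑ xs (f ∘ g)
  ∑-map f g xs = cong sum (sym (map-∘ xs))

  ∑-↭ : {A : Set} (f : A → ℕ) {xs ys : List A} → xs ↭ ys → ∑ xs f ≡ ∑ ys f
  ∑-↭ f p = sum-↭ (Permutation.map⁺ f p)

  ∑-filterᵇ : {A : Set} (p : A → Bool) (f : A → ℕ) → ∀ xs →
    ∑ (filterᵇ p xs) f ≡ ∑ xs (λ x → 𝟙 (p x) * f x)
  ∑-filterᵇ p f []       = refl
  ∑-filterᵇ p f (x ∷ xs) with p x
  ... | true  = cong₂ _+_ (sym (+-identityʳ (f x))) (∑-filterᵇ p f xs)
  ... | false = ∑-filterᵇ p f xs

  length-filterᵇ : {A : Set} (p : A → Bool) → ∀ xs → length (filterᵇ p xs) ≡ ∑ xs (𝟙 ∘ p)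
  length-filterᵇ p []       = refl
  length-filterᵇ p (x ∷ xs) with p x
  ... | true  = cong suc (length-filterᵇ p xs)
  ... | false = length-filterᵇ p xs

  map-allFin-suc : {A : Set} (n : ℕ) (f : Fin (suc n) → A) →
    map f (allFin (suc n)) ≡ f zero ∷ map (f ∘ suc) (allFin n)
  map-allFin-suc n f =
    cong (f zero ∷_) (trans (map-tabulate suc f) (sym (map-tabulate id (f ∘ suc))))

  ∑-allFin-suc : ∀ n (f : Fin (suc n) → ℕ) →
    ∑ (allFin (suc n)) f ≡ f zero + ∑ (allFin n) (f ∘ suc)
  ∑-allFin-suc n f = cong sum (map-allFin-suc n f)

  -- The definitions quantify over positions in an enumeration; this is the passage to the
  -- enumerated objects themselves.
  ∑-allFin-lookup : {A : Set} (f : A → ℕ) {n : ℕ} (v : Vec A n) →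
    ∑ (allFin n) (f ∘ lookup v) ≡ ∑ (toList v) f
  ∑-allFin-lookup f []      = refl
  ∑-allFin-lookup f {suc n} (x ∷ v) =
    trans (∑-allFin-suc n (f ∘ lookup (x ∷ v))) (cong (f x +_) (∑-allFin-lookup f v))

  -- Sums over the cube

  cube : ∀ n → List (Vec Bool n)
  cube n = toList (subsets n)

  -- The trailing `[]` in `subsets` matches `2 ^ suc n`, which unfolds to `2 ^ n + (2 ^ n + 0)`; in
  -- list form it disappears.
  cube-suc : ∀ n → cube (suc n) ≡ map (true ∷_) (cube n) ++ map (false ∷_) (cube n)
  cube-suc n =
    trans (toList-++ (Vec.map (true ∷_) (subsets n)) _)
      (cong₂ _++_ (toList-map (true ∷_) (subsets n))
        (trans (toList-++ (Vec.map (false ∷_) (subsets n)) [])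
          (trans (++-identityʳ _) (toList-map (false ∷_) (subsets n)))))

  ∑-cube-suc : ∀ n (f : Vec Bool (suc n) → ℕ) →
    ∑ (cube (suc n)) f ≡ ∑ (cube n) (f ∘ (true ∷_)) + ∑ (cube n) (f ∘ (false ∷_))
  ∑-cube-suc n f = begin
    ∑ (cube (suc n)) f
      ≡⟨ cong (λ xs → ∑ xs f) (cube-suc n) ⟩
    ∑ (map (true ∷_) (cube n) ++ map (false ∷_) (cube n)) f
      ≡⟨ ∑-++ f (map (true ∷_) (cube n)) _ ⟩
    ∑ (map (true ∷_) (cube n)) f + ∑ (map (false ∷_) (cube n)) f
      ≡⟨ cong₂ _+_ (∑-map f (true ∷_) (cube n)) (∑-map f (false ∷_) (cube n)) ⟩
    ∑ (cube n) (f ∘ (true ∷_)) + ∑ (cube n) (f ∘ (false ∷_)) ∎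
    where open ≡-Reasoning

  ∑-cube-1 : ∀ n → ∑ (cube n) (λ _ → 1) ≡ 2 ^ n
  ∑-cube-1 zero    = refl
  ∑-cube-1 (suc n) =
    trans (∑-cube-suc n _) (cong₂ _+_ (∑-cube-1 n) (trans (∑-cube-1 n) (sym (+-identityʳ _))))

  allF-suc : ∀ n (p : Fin (suc n) → Bool) → allF (suc n) p ≡ p zero ∧ allF n (p ∘ suc)
  allF-suc n p = cong and (map-allFin-suc n p)

  anyF-suc : ∀ n (p : Fin (suc n) → Bool) → anyF (suc n) p ≡ p zero ∨ anyF n (p ∘ suc)
  anyF-suc n p = cong or (map-allFin-suc n p)

  allF-cong : ∀ n {p q : Fin n → Bool} → (∀ i → p i ≡ q i) → allF n p ≡ allF n q
  allF-cong n h = cong and (map-cong h (allFin n))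

  countF-∑ : ∀ n (p : Fin n → Bool) → countF n p ≡ ∑ (allFin n) (𝟙 ∘ p)
  countF-∑ n p = length-filterᵇ p (allFin n)

  -- Weighted counting of the subsets of a finite set of candidates

  insert : {n : ℕ} → Fin n → Vec Bool n → Vec Bool n
  insert x F = F [ x ]≔ true

  within : {n : ℕ} → (Fin n → Bool) → Vec Bool n → Bool
  within {n} p F = allF n (λ t → not (lookup F t) ∨ p t)

  size : {n : ℕ} → Vec Bool n → ℕ
  size {n} F = countF n (lookup F)

  kSubset : {n : ℕ} → (Fin n → Bool) → ℕ → Vec Bool n → Bool
  kSubset p k F = within p F ∧ (size F ≡ᵇ k)

  ∑-kSubsets : {n : ℕ} → (Fin n → Bool) → ℕ → (Vec Bool n → ℕ) → ℕ
  ∑-kSubsets {n} p k φ = ∑ (cube n) (λ F → 𝟙 (kSubset p k F) * φ F)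

  size-∷ : ∀ {n} b (F : Vec Bool n) → size (b ∷ F) ≡ 𝟙 b + size F
  size-∷ {n} b F = begin
    size (b ∷ F)                             ≡⟨ countF-∑ (suc n) (lookup (b ∷ F)) ⟩
    ∑ (allFin (suc n)) (𝟙 ∘ lookup (b ∷ F))  ≡⟨ ∑-allFin-suc n _ ⟩
    𝟙 b + ∑ (allFin n) (𝟙 ∘ lookup F)        ≡⟨ cong (𝟙 b +_) (sym (countF-∑ n (lookup F))) ⟩
    𝟙 b + size F ∎
    where open ≡-Reasoning

  within-∷ : ∀ {n} p b (F : Vec Bool n) → within p (b ∷ F) ≡ (not b ∨ p zero) ∧ within (p ∘ suc) F
  within-∷ {n} p b F = allF-suc n (λ t → not (lookup (b ∷ F) t) ∨ p t)

  insert-∈ : ∀ {n} (x : Fin n) F → lookup F x ≡ true → insert x F ≡ F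
  insert-∈ zero    (b ∷ F) refl = refl
  insert-∈ (suc x) (b ∷ F) eq   = cong (b ∷_) (insert-∈ x F eq)

  size-insert : ∀ {n} (x : Fin n) F → lookup F x ≡ false → size (insert x F) ≡ suc (size F)
  size-insert zero    (false ∷ F) refl = trans (size-∷ true F) (cong suc (sym (size-∷ false F)))
  size-insert (suc x) (b ∷ F)     eq   = begin
    size (b ∷ insert x F)    ≡⟨ size-∷ b (insert x F) ⟩
    𝟙 b + size (insert x F)  ≡⟨ cong (𝟙 b +_) (size-insert x F eq) ⟩
    𝟙 b + suc (size F)       ≡⟨ +-suc (𝟙 b) (size F) ⟩
    suc (𝟙 b + size F)       ≡⟨ cong suc (sym (size-∷ b F)) ⟩
    suc (size (b ∷ F)) ∎
    where open ≡-Reasoning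

  within-insert : ∀ {n} (p : Fin n → Bool) x F → p x ≡ true → within p (insert x F) ≡ within p F
  within-insert p zero (b ∷ F) px = begin
    within p (true ∷ F)                          ≡⟨ within-∷ p true F ⟩
    p zero ∧ within (p ∘ suc) F                  ≡⟨ cong (_∧ within (p ∘ suc) F) (lemma b px) ⟩
    (not b ∨ p zero) ∧ within (p ∘ suc) F        ≡⟨ sym (within-∷ p b F) ⟩
    within p (b ∷ F) ∎
    where
    open ≡-Reasoning
    lemma : ∀ b {c} → c ≡ true → c ≡ not b ∨ c
    lemma true  _    = refl
    lemma false refl = refl
  within-insert p (suc x) (b ∷ F) px = begin
    within p (b ∷ insert x F)                           ≡⟨ within-∷ p b (insert x F) ⟩
    (not b ∨ p zero) ∧ within (p ∘ suc) (insert x F)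
      ≡⟨ cong ((not b ∨ p zero) ∧_) (within-insert (p ∘ suc) x F px) ⟩
    (not b ∨ p zero) ∧ within (p ∘ suc) F               ≡⟨ sym (within-∷ p b F) ⟩
    within p (b ∷ F) ∎
    where open ≡-Reasoning

  kSubset-insert : ∀ {n} (p : Fin n → Bool) k x F → p x ≡ true → lookup F x ≡ false →
    kSubset p (suc k) (insert x F) ≡ kSubset p k F
  kSubset-insert p k x F px x∉F =
    cong₂ _∧_ (within-insert p x F px) (cong (_≡ᵇ suc k) (size-insert x F x∉F))

  ∑-members : ∀ {n} (p : Fin n → Bool) F → T (within p F) →
    ∑ (allFin n) (λ x → 𝟙 (p x) * 𝟙 (lookup F x)) ≡ size F
  ∑-members p []      _ = refl
  ∑-members {suc n} p (b ∷ F) w = begin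
    ∑ (allFin (suc n)) (λ x → 𝟙 (p x) * 𝟙 (lookup (b ∷ F) x))
      ≡⟨ ∑-allFin-suc n _ ⟩
    𝟙 (p zero) * 𝟙 b + ∑ (allFin n) (λ x → 𝟙 (p (suc x)) * 𝟙 (lookup F x))
      ≡⟨ cong₂ _+_ (head b (p zero) (proj₁ w′)) (∑-members (p ∘ suc) F (proj₂ w′)) ⟩
    𝟙 b + size F
      ≡⟨ sym (size-∷ b F) ⟩
    size (b ∷ F) ∎
    where
    open ≡-Reasoning
    w′ = to T-∧ (subst T (within-∷ p b F) w)
    head : ∀ b c → T (not b ∨ c) → 𝟙 c * 𝟙 b ≡ 𝟙 b
    head true  true  _ = refl
    head false c     _ = *-zeroʳ (𝟙 c)

  -- Keeping the indicator on both sides makes the identity unconditional: either it vanishes, or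
  -- `F` lies within `p` and its members number `k`.
  ∑-members-kSubset : ∀ {n} (p : Fin n → Bool) k F →
    ∑ (allFin n) (λ x → 𝟙 (p x) * 𝟙 (lookup F x)) * 𝟙 (kSubset p k F) ≡ k * 𝟙 (kSubset p k F)
  ∑-members-kSubset {n} p k F = go (within p F) refl (size F ≡ᵇ k) refl
    where
    M = ∑ (allFin n) (λ x → 𝟙 (p x) * 𝟙 (lookup F x))
    go : ∀ a → within p F ≡ a → ∀ b → (size F ≡ᵇ k) ≡ b → M * 𝟙 (a ∧ b) ≡ k * 𝟙 (a ∧ b)
    go false _  b     _  = trans (*-zeroʳ M) (sym (*-zeroʳ k))
    go true  _  false _  = trans (*-zeroʳ M) (sym (*-zeroʳ k))
    go true  w  true  s  = cong (_* 1)
      (trans (∑-members p F (subst T (sym w) _)) (≡ᵇ⇒≡ (size F) k (subst T (sym s) _)))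

  ∑-over-members : ∀ {n} (p : Fin n → Bool) k (φ : Vec Bool n → ℕ) →
    ∑ (cube n) (λ F → ∑ (allFin n) (λ x → 𝟙 (p x) * 𝟙 (lookup F x) * (𝟙 (kSubset p k F) * φ F)))
      ≡ k * ∑-kSubsets p k φ
  ∑-over-members {n} p k φ =
    trans (∑-cong each (cube n)) (*-distribˡ-∑ k (λ F → 𝟙 (kSubset p k F) * φ F) (cube n))
    where
    open ≡-Reasoning
    each : ∀ F → ∑ (allFin n) (λ x → 𝟙 (p x) * 𝟙 (lookup F x) * (𝟙 (kSubset p k F) * φ F))
               ≡ k * (𝟙 (kSubset p k F) * φ F)
    each F = begin
      ∑ (allFin n) (λ x → 𝟙 (p x) * 𝟙 (lookup F x) * (𝟙 (kSubset p k F) * φ F))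
        ≡⟨ *-distribʳ-∑ (𝟙 (kSubset p k F) * φ F) _ (allFin n) ⟩
      M * (𝟙 (kSubset p k F) * φ F)
        ≡⟨ sym (*-assoc M (𝟙 (kSubset p k F)) (φ F)) ⟩
      M * 𝟙 (kSubset p k F) * φ F
        ≡⟨ cong (_* φ F) (∑-members-kSubset p k F) ⟩
      k * 𝟙 (kSubset p k F) * φ F
        ≡⟨ *-assoc k (𝟙 (kSubset p k F)) (φ F) ⟩
      k * (𝟙 (kSubset p k F) * φ F) ∎
      where M = ∑ (allFin n) (λ x → 𝟙 (p x) * 𝟙 (lookup F x))

  -- Insertion of `x` is a bijection from the sets avoiding `x` onto the sets containing it.
  ∑-insert : ∀ {n} (x : Fin n) (ψ : Vec Bool n → ℕ) →
    ∑ (cube n) (λ F → 𝟙 (not (lookup F x)) * ψ (insert x F)) ≡ ∑ (cube n) (λ F → 𝟙 (lookup F x) * ψ F)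
  ∑-insert {suc n} zero ψ = begin
    ∑ (cube (suc n)) (λ F → 𝟙 (not (lookup F zero)) * ψ (insert zero F))
      ≡⟨ ∑-cube-suc n _ ⟩
    ∑ (cube n) (λ F → 0) + ∑ (cube n) (λ F → 1 * ψ (true ∷ F))
      ≡⟨ +-comm (∑ (cube n) (λ F → 0)) _ ⟩
    ∑ (cube n) (λ F → 1 * ψ (true ∷ F)) + ∑ (cube n) (λ F → 0)
      ≡⟨ sym (∑-cube-suc n _) ⟩
    ∑ (cube (suc n)) (λ F → 𝟙 (lookup F zero) * ψ F) ∎
    where open ≡-Reasoning
  ∑-insert {suc n} (suc x) ψ =
    trans (∑-cube-suc n _)
      (trans (cong₂ _+_ (∑-insert x (ψ ∘ (true ∷_))) (∑-insert x (ψ ∘ (false ∷_))))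
        (sym (∑-cube-suc n _)))

  -- Inserting x either leaves F unchanged, when x is one of its k members, or yields a
  -- (k+1)-subset, which arises in this way from each of its k+1 members.
  ∑-kSubsets-insert : ∀ {n} (p : Fin n → Bool) k (φ : Vec Bool n → ℕ) →
    ∑-kSubsets p k (λ F → ∑ (allFin n) (λ x → 𝟙 (p x) * φ (insert x F)))
      ≡ k * ∑-kSubsets p k φ + suc k * ∑-kSubsets p (suc k) φ
  ∑-kSubsets-insert {n} p k φ = begin
    ∑-kSubsets p k (λ F → ∑ (allFin n) (λ x → 𝟙 (p x) * φ (insert x F)))
      ≡⟨ ∑-cong (λ F → trans (sym (*-distribˡ-∑ (𝟙 (kSubset p k F)) _ (allFin n)))
           (trans (∑-cong (λ x → split F x) (allFin n))
             (∑-distrib-+ (old F) (new F) (allFin n)))) (cube n) ⟩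
    ∑ (cube n) (λ F → ∑ (allFin n) (old F) + ∑ (allFin n) (new F))
      ≡⟨ ∑-distrib-+ _ _ (cube n) ⟩
    ∑ (cube n) (λ F → ∑ (allFin n) (old F)) + ∑ (cube n) (λ F → ∑ (allFin n) (new F))
      ≡⟨ cong₂ _+_ (∑-over-members p k φ) newSum ⟩
    k * ∑-kSubsets p k φ + suc k * ∑-kSubsets p (suc k) φ ∎
    where
    open ≡-Reasoning
    old new : Vec Bool n → Fin n → ℕ
    old F x = 𝟙 (p x) * 𝟙 (lookup F x) * (𝟙 (kSubset p k F) * φ F)
    -- The condition on `F` is rewritten as one on `insert x F`, so that apart from the guards the
    -- summand depends only on the enlarged set, as `∑-insert` requires.
    new F x = 𝟙 (p x) * (𝟙 (not (lookup F x)) * (𝟙 (kSubset p (suc k) (insert x F)) * φ (insert x F)))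

    split : ∀ F x → 𝟙 (kSubset p k F) * (𝟙 (p x) * φ (insert x F)) ≡ old F x + new F x
    split F x with p x in px | lookup F x in Fx
    ... | false | _     = *-zeroʳ (𝟙 (kSubset p k F))
    ... | true  | true  = trans (cong (λ G → 𝟙 (kSubset p k F) * (1 * φ G)) (insert-∈ x F Fx))
      (rearrange (𝟙 (kSubset p k F)) (φ F))
      where
      rearrange : ∀ a b → a * (1 * b) ≡ 1 * (a * b) + 1 * 0
      rearrange = solve-∀
    ... | true  | false =
      trans (rearrange (𝟙 (kSubset p k F)) (φ (insert x F)))
        (cong (λ c → 1 * (1 * (𝟙 c * φ (insert x F)))) (sym (kSubset-insert p k x F px Fx)))
      where
      rearrange : ∀ a b → a * (1 * b) ≡ 1 * (1 * (a * b))
      rearrange = solve-∀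

    newSum : ∑ (cube n) (λ F → ∑ (allFin n) (new F)) ≡ suc k * ∑-kSubsets p (suc k) φ
    newSum = begin
      ∑ (cube n) (λ F → ∑ (allFin n) (new F))
        ≡⟨ ∑-swap new (cube n) (allFin n) ⟩
      ∑ (allFin n) (λ x → ∑ (cube n) (λ F → new F x))
        ≡⟨ ∑-cong (λ x → trans (*-distribˡ-∑ (𝟙 (p x)) _ (cube n))
             (trans (cong (𝟙 (p x) *_) (∑-insert x (λ F → 𝟙 (kSubset p (suc k) F) * φ F)))
               (trans (sym (*-distribˡ-∑ (𝟙 (p x)) _ (cube n)))
                 (∑-cong (λ F → sym (*-assoc (𝟙 (p x)) (𝟙 (lookup F x)) _)) (cube n))))) (allFin n) ⟩
      ∑ (allFin n) (λ x → ∑ (cube n) (λ F → 𝟙 (p x) * 𝟙 (lookup F x) * (𝟙 (kSubset p (suc k) F) * φ F)))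
        ≡⟨ ∑-swap _ (allFin n) (cube n) ⟩
      ∑ (cube n) (λ F → ∑ (allFin n) (λ x → 𝟙 (p x) * 𝟙 (lookup F x) * (𝟙 (kSubset p (suc k) F) * φ F)))
        ≡⟨ ∑-over-members p (suc k) φ ⟩
      suc k * ∑-kSubsets p (suc k) φ ∎

  ∑-kSubsets-zero : ∀ {n} (p : Fin n → Bool) (φ : Vec Bool n → ℕ) →
    ∑-kSubsets p 0 φ ≡ φ (replicate n false)
  ∑-kSubsets-zero {zero}  p φ = trans (+-identityʳ _) (+-identityʳ _)
  ∑-kSubsets-zero {suc n} p φ = begin
    ∑-kSubsets p 0 φ
      ≡⟨ ∑-cube-suc n _ ⟩
    ∑ (cube n) (λ F → 𝟙 (kSubset p 0 (true ∷ F)) * φ (true ∷ F))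
      + ∑ (cube n) (λ F → 𝟙 (kSubset p 0 (false ∷ F)) * φ (false ∷ F))
      ≡⟨ cong₂ _+_ (trans (∑-cong present (cube n)) (∑-zero (cube n))) (∑-cong absent (cube n)) ⟩
    ∑-kSubsets (p ∘ suc) 0 (φ ∘ (false ∷_))
      ≡⟨ ∑-kSubsets-zero (p ∘ suc) (φ ∘ (false ∷_)) ⟩
    φ (false ∷ replicate n false) ∎
    where
    open ≡-Reasoning
    present : ∀ F → 𝟙 (kSubset p 0 (true ∷ F)) * φ (true ∷ F) ≡ 0
    present F = cong (λ b → 𝟙 b * φ (true ∷ F))
      (trans (cong (λ s → within p (true ∷ F) ∧ (s ≡ᵇ 0)) (size-∷ true F)) (∧-zeroʳ _))
    absent : ∀ F → 𝟙 (kSubset p 0 (false ∷ F)) * φ (false ∷ F)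
                 ≡ 𝟙 (kSubset (p ∘ suc) 0 F) * φ (false ∷ F)
    absent F = cong (λ b → 𝟙 b * φ (false ∷ F))
      (cong₂ (λ a s → a ∧ (s ≡ᵇ 0)) (within-∷ p false F) (size-∷ false F))

  T-extensional : ∀ a b → (T a → T b) → (T b → T a) → a ≡ b
  T-extensional true  true  _ _ = refl
  T-extensional true  false f _ = contradiction tt f
  T-extensional false true  _ g = contradiction tt g
  T-extensional false false _ _ = refl

  T-allF : ∀ n (p : Fin n → Bool) → T (allF n p) ⇔ (∀ i → T (p i))
  T-allF n p = mk⇔ (λ h i → All.lookup (All.all⁺ p (allFin n) h) (∈-allFin i))
                   (λ h → All.all⁻ p {xs = allFin n} (All.tabulate (λ {i} _ → h i)))

  -- Cut relations and their separation

  Cut : ℕ → Set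
  Cut n = Fin n → Fin n → Bool

  infix 4 _≈_
  infixl 6 _∪_

  _≈_ : {n : ℕ} → Cut n → Cut n → Set
  R ≈ S = ∀ a b → R a b ≡ S a b

  _∪_ : {n : ℕ} → Cut n → Cut n → Cut n
  (R ∪ S) a b = R a b ∨ S a b

  none : {n : ℕ} → Cut n
  none a b = false

  ∪-cong : ∀ {n} {R R′ S S′ : Cut n} → R ≈ R′ → S ≈ S′ → R ∪ S ≈ R′ ∪ S′
  ∪-cong r s a b = cong₂ _∨_ (r a b) (s a b)

  -- Cut relations are functions, and the rearranged unions that occur below agree only pointwise;
  -- weights therefore have to respect `_≈_`.
  Extensional : {n : ℕ} → (Cut n → ℕ) → Set
  Extensional Ψ = ∀ {R S} → R ≈ S → Ψ R ≡ Ψ S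

  -- Has the shape of `separatingᵇ`, so that on the cut relation of a family the two agree by
  -- computation.
  separates : {n : ℕ} → Cut n → Bool
  separates {n} R = allF n (λ a → allF n (λ b → ⌊ a Fin.≟ b ⌋ ∨ R a b))

  separates-ext : ∀ {n} → Extensional {n} (𝟙 ∘ separates)
  separates-ext {n} R≈S =
    cong 𝟙 (allF-cong n (λ a → allF-cong n (λ b → cong (⌊ a Fin.≟ b ⌋ ∨_) (R≈S a b))))

  T-separates : ∀ {n} (R : Cut n) → T (separates R) ⇔ (∀ a b → a ≢ b → T (R a b))
  T-separates {n} R = mk⇔ ⇒ ⇐
    where
    ⇒ : T (separates R) → ∀ a b → a ≢ b → T (R a b)
    ⇒ h a b a≢b with a Fin.≟ b | to (T-allF n _) (to (T-allF n _) h a) b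
    ... | yes a≡b | _ = contradiction a≡b a≢b
    ... | no _    | r = r
    ⇐ : (∀ a b → a ≢ b → T (R a b)) → T (separates R)
    ⇐ h = from (T-allF n _) (λ a → from (T-allF n _) (λ b → each a b))
      where
      each : ∀ a b → T (⌊ a Fin.≟ b ⌋ ∨ R a b)
      each a b with a Fin.≟ b
      ... | yes _   = tt
      ... | no  a≢b = h a b a≢b

  -- Inequality as a disjunction of bitwise `xor`s: this form makes prepending a row to a matrix a
  -- union of cut relations.
  differ : {l : ℕ} → Vec Bool l → Vec Bool l → Bool
  differ []       []       = false
  differ (x ∷ xs) (y ∷ ys) = (x xor y) ∨ differ xs ys

  differ-comm : ∀ {l} (x y : Vec Bool l) → differ x y ≡ differ y x
  differ-comm []       []       = refl
  differ-comm (x ∷ xs) (y ∷ ys) = cong₂ _∨_ (xor-comm x y) (differ-comm xs ys)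

  differ-refl : ∀ {l} (x : Vec Bool l) → differ x x ≡ false
  differ-refl []       = refl
  differ-refl (x ∷ xs) = cong₂ _∨_ (xor-same x) (differ-refl xs)

  -- A bipartition is encoded by a bit for each element other than zero, telling
  -- whether it is cut from zero; a sequence of l bipartitions by the column of
  -- l bits of each such element.
  bitCut : {m : ℕ} → Vec Bool m → Cut (suc m)
  bitCut v a b = lookup (false ∷ v) a xor lookup (false ∷ v) b

  -- The element `zero` is never cut from itself, hence its zero column. With it included, "distinct
  -- and nonzero" becomes plain distinctness.
  columns : {m l : ℕ} → Vec (Vec Bool l) m → Vec (Vec Bool l) (suc m)
  columns {l = l} M = replicate l false ∷ M

  columnCut : {m l : ℕ} → Vec (Vec Bool l) m → Cut (suc m)
  columnCut M a b = differ (lookup (columns M) a) (lookup (columns M) b)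

  bitCut-replicate : ∀ {m} → bitCut (replicate m false) ≈ none
  bitCut-replicate {m} a b = cong₂ _xor_ (lookup-replicate a false) (lookup-replicate b false)

  columnCut-zipWith : ∀ {m l} (v : Vec Bool m) (M : Vec (Vec Bool l) m) →
    columnCut (zipWith _∷_ v M) ≈ bitCut v ∪ columnCut M
  columnCut-zipWith {l = l} v M a b =
    cong₂ differ (lookup-zipWith _∷_ a (false ∷ v) (columns M)) (lookup-zipWith _∷_ b (false ∷ v) (columns M))

  -- The operator `E` at the level of cut relations; the zero vector stands for the trivial
  -- bipartition.
  adjoin : {m : ℕ} → (Cut (suc m) → ℕ) → Cut (suc m) → ℕ
  adjoin {m} Ψ R = ∑ (cube m) (λ v → Ψ (R ∪ bitCut v))

  adjoin^ : {m : ℕ} → ℕ → (Cut (suc m) → ℕ) → Cut (suc m) → ℕ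
  adjoin^ zero    Ψ = Ψ
  adjoin^ (suc l) Ψ = adjoin (adjoin^ l Ψ)

  adjoin^-ext : ∀ {m} l {Ψ : Cut (suc m) → ℕ} → Extensional Ψ → Extensional (adjoin^ l Ψ)
  adjoin^-ext     zero    ext R≈S = ext R≈S
  adjoin^-ext {m} (suc l) ext R≈S =
    ∑-cong (λ v → adjoin^-ext l ext (∪-cong {S = bitCut v} R≈S (λ _ _ → refl))) (cube m)

  -- Sums over vectors with entries from a list

  ∑ᵛ : {A : Set} → List A → (m : ℕ) → (Vec A m → ℕ) → ℕ
  ∑ᵛ xs zero    f = f []
  ∑ᵛ xs (suc m) f = ∑ xs (λ x → ∑ᵛ xs m (f ∘ (x ∷_)))

  ∑ᵛ-cong : {A : Set} (xs : List A) → ∀ m {f g : Vec A m → ℕ} → (∀ v → f v ≡ g v) → ∑ᵛ xs m f ≡ ∑ᵛ xs m g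
  ∑ᵛ-cong xs zero    h = h []
  ∑ᵛ-cong xs (suc m) h = ∑-cong (λ x → ∑ᵛ-cong xs m (h ∘ (x ∷_))) xs

  ∑-∑ᵛ-swap : {A B : Set} (xs : List A) (ys : List B) → ∀ m (f : A → Vec B m → ℕ) →
    ∑ xs (λ x → ∑ᵛ ys m (f x)) ≡ ∑ᵛ ys m (λ M → ∑ xs (λ x → f x M))
  ∑-∑ᵛ-swap xs ys zero    f = refl
  ∑-∑ᵛ-swap xs ys (suc m) f =
    trans (∑-swap _ xs ys) (∑-cong (λ y → ∑-∑ᵛ-swap xs ys m (λ x → f x ∘ (y ∷_))) ys)

  *-distribˡ-∑ᵛ : {A : Set} (xs : List A) → ∀ m c (f : Vec A m → ℕ) →
    ∑ᵛ xs m (λ v → c * f v) ≡ c * ∑ᵛ xs m f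
  *-distribˡ-∑ᵛ xs zero    c f = refl
  *-distribˡ-∑ᵛ xs (suc m) c f =
    trans (∑-cong (λ x → *-distribˡ-∑ᵛ xs m c (f ∘ (x ∷_))) xs) (*-distribˡ-∑ c _ xs)

  -- A matrix with `suc l` rows is a first row on top of a matrix with `l` rows. The left side
  -- chooses the first row separately, the right side chooses whole columns; the induction is on the
  -- columns.
  ∑-zipWith : ∀ l m (f : Vec (Vec Bool (suc l)) m → ℕ) →
    ∑ (cube m) (λ v → ∑ᵛ (cube l) m (λ M → f (zipWith _∷_ v M))) ≡ ∑ᵛ (cube (suc l)) m f
  ∑-zipWith l zero    f = +-identityʳ (f [])
  ∑-zipWith l (suc m) f = begin
    ∑ (cube (suc m)) (λ v → ∑ (cube l) (λ c → ∑ᵛ (cube l) m (λ M → f (zipWith _∷_ v (c ∷ M)))))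
      ≡⟨ ∑-cube-suc m _ ⟩
    ∑ (cube m) (λ v → ∑ (cube l) (λ c → ∑ᵛ (cube l) m (λ M → f ((true ∷ c) ∷ zipWith _∷_ v M))))
      + ∑ (cube m) (λ v → ∑ (cube l) (λ c → ∑ᵛ (cube l) m (λ M → f ((false ∷ c) ∷ zipWith _∷_ v M))))
      ≡⟨ cong₂ _+_ (half true) (half false) ⟩
    ∑ (cube l) (λ c → ∑ᵛ (cube (suc l)) m (λ M → f ((true ∷ c) ∷ M)))
      + ∑ (cube l) (λ c → ∑ᵛ (cube (suc l)) m (λ M → f ((false ∷ c) ∷ M)))
      ≡⟨ sym (∑-cube-suc l _) ⟩
    ∑ᵛ (cube (suc l)) (suc m) f ∎
    where
    open ≡-Reasoning
    half : ∀ b →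
      ∑ (cube m) (λ v → ∑ (cube l) (λ c → ∑ᵛ (cube l) m (λ M → f ((b ∷ c) ∷ zipWith _∷_ v M))))
        ≡ ∑ (cube l) (λ c → ∑ᵛ (cube (suc l)) m (λ M → f ((b ∷ c) ∷ M)))
    half b = trans (∑-swap _ (cube m) (cube l))
      (∑-cong (λ c → ∑-zipWith l m (λ M → f ((b ∷ c) ∷ M))) (cube l))

  -- The relation `R` is arbitrary because it accumulates the rows already adjoined when the
  -- induction descends.
  adjoin^-columns : ∀ {m} l (Ψ : Cut (suc m) → ℕ) → Extensional Ψ → ∀ R →
    adjoin^ l Ψ R ≡ ∑ᵛ (cube l) m (λ M → Ψ (R ∪ columnCut M))
  adjoin^-columns {m} zero Ψ ext R =
    trans (ext (λ a b → sym (trans (cong (R a b ∨_) (differ-[] (lookup M a) (lookup M b))) (∨-identityʳ _))))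
      (sym (const-[] m))
    where
    M = columns (replicate m [])
    differ-[] : (x y : Vec Bool 0) → differ x y ≡ false
    differ-[] [] [] = refl
    const-[] : ∀ k {f : Vec (Vec Bool 0) k → ℕ} → ∑ᵛ (cube 0) k f ≡ f (replicate k [])
    const-[] zero    = refl
    const-[] (suc k) = trans (+-identityʳ _) (const-[] k)
  adjoin^-columns {m} (suc l) Ψ ext R = begin
    ∑ (cube m) (λ v → adjoin^ l Ψ (R ∪ bitCut v))
      ≡⟨ ∑-cong (λ v → adjoin^-columns l Ψ ext (R ∪ bitCut v)) (cube m) ⟩
    ∑ (cube m) (λ v → ∑ᵛ (cube l) m (λ M → Ψ (R ∪ bitCut v ∪ columnCut M)))
      ≡⟨ ∑-cong (λ v → ∑ᵛ-cong (cube l) m (λ M → ext (λ a b →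
           trans (∨-assoc (R a b) _ _) (cong (R a b ∨_) (sym (columnCut-zipWith v M a b)))))) (cube m) ⟩
    ∑ (cube m) (λ v → ∑ᵛ (cube l) m (λ M → Ψ (R ∪ columnCut (zipWith _∷_ v M))))
      ≡⟨ ∑-zipWith l m (λ M → Ψ (R ∪ columnCut M)) ⟩
    ∑ᵛ (cube (suc l)) m (λ M → Ψ (R ∪ columnCut M)) ∎
    where open ≡-Reasoning

  -- Counting matrices with distinct nonzero columns

  fresh : {k l : ℕ} → Vec Bool l → Vec (Vec Bool l) k → Bool
  fresh c []      = true
  fresh c (d ∷ w) = differ c d ∧ fresh c w

  distinct : {k l : ℕ} → Vec (Vec Bool l) k → Bool
  distinct []      = true
  distinct (c ∷ w) = fresh c w ∧ distinct w

  T-fresh : ∀ {k l} (c : Vec Bool l) (w : Vec (Vec Bool l) k) →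
    T (fresh c w) ⇔ (∀ a → T (differ c (lookup w a)))
  T-fresh c w = mk⇔ (⇒ w) (⇐ w)
    where
    ⇒ : ∀ {k} (w : Vec _ k) → T (fresh c w) → ∀ a → T (differ c (lookup w a))
    ⇒ (d ∷ w) h zero    = proj₁ (to T-∧ h)
    ⇒ (d ∷ w) h (suc a) = ⇒ w (proj₂ (to (T-∧ {differ c d}) h)) a
    ⇐ : ∀ {k} (w : Vec _ k) → (∀ a → T (differ c (lookup w a))) → T (fresh c w)
    ⇐ []      h = tt
    ⇐ (d ∷ w) h = from T-∧ (h zero , ⇐ w (h ∘ suc))

  T-distinct : ∀ {k l} (w : Vec (Vec Bool l) k) →
    T (distinct w) ⇔ (∀ a b → a ≢ b → T (differ (lookup w a) (lookup w b)))
  T-distinct w = mk⇔ (⇒ w) (⇐ w)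
    where
    ⇒ : ∀ {k} (w : Vec _ k) → T (distinct w) → ∀ a b → a ≢ b → T (differ (lookup w a) (lookup w b))
    ⇒ (c ∷ w) h zero    zero    a≢b = contradiction refl a≢b
    ⇒ (c ∷ w) h zero    (suc b) a≢b = to (T-fresh c w) (proj₁ (to T-∧ h)) b
    ⇒ (c ∷ w) h (suc a) zero    a≢b =
      subst T (differ-comm c (lookup w a)) (to (T-fresh c w) (proj₁ (to T-∧ h)) a)
    ⇒ (c ∷ w) h (suc a) (suc b) a≢b = ⇒ w (proj₂ (to (T-∧ {fresh c w}) h)) a b (a≢b ∘ cong suc)
    ⇐ : ∀ {k} (w : Vec _ k) → (∀ a b → a ≢ b → T (differ (lookup w a) (lookup w b))) → T (distinct w)
    ⇐ []      h = tt
    ⇐ (c ∷ w) h = from T-∧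
      ( from (T-fresh c w) (λ a → h zero (suc a) (λ ()))
      , ⇐ w (λ a b a≢b → h (suc a) (suc b) (a≢b ∘ Fin.suc-injective)))

  -- Both sides say that different positions carry different columns; `none ∪ columnCut M` computes
  -- pointwise to `columnCut M`.
  separates-columns : ∀ {m l} (M : Vec (Vec Bool l) m) → separates (none ∪ columnCut M) ≡ distinct (columns M)
  separates-columns M = T-extensional _ _
    (λ h → from (T-distinct (columns M)) (to (T-separates (none ∪ columnCut M)) h))
    (λ h → from (T-separates (none ∪ columnCut M)) (to (T-distinct (columns M)) h))

  -- The factor `𝟙 (not (differ c d))` is a Kronecker delta at `d`.
  ∑-not-differ : ∀ {l} (d : Vec Bool l) (f : Vec Bool l → ℕ) →
    ∑ (cube l) (λ c → 𝟙 (not (differ c d)) * f c) ≡ f d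
  ∑-not-differ []          f = trans (+-identityʳ _) (+-identityʳ _)
  ∑-not-differ {suc l} (true ∷ d) f = begin
    ∑ (cube (suc l)) (λ c → 𝟙 (not (differ c (true ∷ d))) * f c)
      ≡⟨ ∑-cube-suc l _ ⟩
    ∑ (cube l) (λ c → 𝟙 (not (differ c d)) * f (true ∷ c)) + ∑ (cube l) (λ _ → 0)
      ≡⟨ cong₂ _+_ (∑-not-differ d (f ∘ (true ∷_))) (∑-zero (cube l)) ⟩
    f (true ∷ d) + 0
      ≡⟨ +-identityʳ _ ⟩
    f (true ∷ d) ∎
    where open ≡-Reasoning
  ∑-not-differ {suc l} (false ∷ d) f =
    trans (∑-cube-suc l _) (cong₂ _+_ (∑-zero (cube l)) (∑-not-differ d (f ∘ (false ∷_))))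

  -- Each further column `d` forbids exactly one more value, since `d` was itself fresh for the
  -- others. Stating it with `+ k` keeps the induction free of truncated subtraction.
  ∑-fresh : ∀ {k l} (w : Vec (Vec Bool l) k) → T (distinct w) →
    ∑ (cube l) (λ c → 𝟙 (fresh c w)) + k ≡ 2 ^ l
  ∑-fresh {l = l} []      _ = trans (+-identityʳ _) (∑-cube-1 l)
  ∑-fresh {suc k} {l} (d ∷ w) h = begin
    ∑ (cube l) (λ c → 𝟙 (fresh c (d ∷ w))) + suc k
      ≡⟨ +-suc (∑ (cube l) (λ c → 𝟙 (fresh c (d ∷ w)))) k ⟩
    suc (∑ (cube l) (λ c → 𝟙 (fresh c (d ∷ w))) + k)
      ≡⟨ cong (_+ k) (+-comm 1 (∑ (cube l) (λ c → 𝟙 (fresh c (d ∷ w))))) ⟩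
    ∑ (cube l) (λ c → 𝟙 (fresh c (d ∷ w))) + 1 + k
      ≡⟨ cong (λ s → ∑ (cube l) (λ c → 𝟙 (fresh c (d ∷ w))) + s + k)
           (sym (trans (∑-not-differ d (λ c → 𝟙 (fresh c w))) (𝟙-T (proj₁ (to T-∧ h))))) ⟩
    ∑ (cube l) (λ c → 𝟙 (fresh c (d ∷ w))) + ∑ (cube l) (λ c → 𝟙 (not (differ c d)) * 𝟙 (fresh c w)) + k
      ≡⟨ cong (_+ k) (sym (∑-distrib-+ _ _ (cube l))) ⟩
    ∑ (cube l) (λ c → 𝟙 (fresh c (d ∷ w)) + 𝟙 (not (differ c d)) * 𝟙 (fresh c w)) + k
      ≡⟨ cong (_+ k) (∑-cong (λ c → split (differ c d) (fresh c w)) (cube l)) ⟩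
    ∑ (cube l) (λ c → 𝟙 (fresh c w)) + k
      ≡⟨ ∑-fresh w (proj₂ (to (T-∧ {fresh d w}) h)) ⟩
    2 ^ l ∎
    where
    open ≡-Reasoning
    𝟙-T : ∀ {b} → T b → 𝟙 b ≡ 1
    𝟙-T {true} _ = refl
    split : ∀ a b → 𝟙 (a ∧ b) + 𝟙 (not a) * 𝟙 b ≡ 𝟙 b
    split true  b = +-identityʳ (𝟙 b)
    split false b = +-identityʳ (𝟙 b)

  -- If `w` is distinct then `k` is at most `2 ^ l` and the difference is genuine; otherwise both
  -- sides vanish.
  ∑-distinct-∷ : ∀ {k l} (w : Vec (Vec Bool l) k) →
    ∑ (cube l) (λ c → 𝟙 (distinct (c ∷ w))) ≡ (2 ^ l ∸ k) * 𝟙 (distinct w)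
  ∑-distinct-∷ {k} {l} w =
    trans (∑-cong (λ c → 𝟙-∧ (fresh c w) (distinct w)) (cube l))
      (trans (*-distribʳ-∑ (𝟙 (distinct w)) _ (cube l)) (go (distinct w) refl))
    where
    S = ∑ (cube l) (λ c → 𝟙 (fresh c w))
    go : ∀ b → distinct w ≡ b → S * 𝟙 b ≡ (2 ^ l ∸ k) * 𝟙 b
    go false _  = trans (*-zeroʳ S) (sym (*-zeroʳ (2 ^ l ∸ k)))
    go true  eq = cong (_* 1)
      (trans (sym (m+n∸n≡m S k)) (cong (_∸ k) (∑-fresh w (subst T (sym eq) tt))))

  -- Brings a new column in front of the zero column, where `∑-distinct-∷` can count its values.
  distinct-swap : ∀ {k l} (c d : Vec Bool l) (w : Vec (Vec Bool l) k) →
    distinct (c ∷ d ∷ w) ≡ distinct (d ∷ c ∷ w)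
  distinct-swap c d w rewrite differ-comm c d = swap (differ d c) (fresh c w) (fresh d w) (distinct w)
    where
    swap : ∀ x y z t → (x ∧ y) ∧ (z ∧ t) ≡ (x ∧ z) ∧ (y ∧ t)
    swap true  true  z t = refl
    swap true  false true  t = refl
    swap true  false false t = refl
    swap false y z t = refl

  -- Truncation is harmless, as `b C m` is zero when `b < m`. The induction on `b` uses Pascal's
  -- rule on both sides.
  absorption : ∀ b m → suc m * (b C suc m) ≡ (b ∸ m) * (b C m)
  absorption zero    m = trans (cong (suc m *_) (k>n⇒nCk≡0 {0} {suc m} (s≤s z≤n)))
    (trans (*-zeroʳ (suc m)) (sym (cong (_* (0 C m)) (0∸n≡0 m))))
  absorption (suc b) zero = begin
    1 * (suc b C 1)  ≡⟨ *-identityˡ _ ⟩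
    suc b C 1        ≡⟨ nC1≡n (suc b) ⟩
    suc b            ≡⟨ sym (*-identityʳ (suc b)) ⟩
    suc b * 1 ∎
    where open ≡-Reasoning
  absorption (suc b) (suc m) = begin
    suc (suc m) * (suc b C suc (suc m))
      ≡⟨ cong (suc (suc m) *_) (sym (nCk+nC[k+1]≡[n+1]C[k+1] b (suc m))) ⟩
    suc (suc m) * (b C suc m + b C suc (suc m))
      ≡⟨ *-distribˡ-+ (suc (suc m)) (b C suc m) _ ⟩
    suc (suc m) * (b C suc m) + suc (suc m) * (b C suc (suc m))
      ≡⟨ cong (suc (suc m) * (b C suc m) +_) (absorption b (suc m)) ⟩
    suc (suc m) * (b C suc m) + (b ∸ suc m) * (b C suc m)
      ≡⟨ shift ⟩
    (b ∸ m) * (b C suc m) + suc m * (b C suc m)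
      ≡⟨ cong ((b ∸ m) * (b C suc m) +_) (absorption b m) ⟩
    (b ∸ m) * (b C suc m) + (b ∸ m) * (b C m)
      ≡⟨ trans (+-comm ((b ∸ m) * (b C suc m)) _) (sym (*-distribˡ-+ (b ∸ m) (b C m) _)) ⟩
    (b ∸ m) * (b C m + b C suc m)
      ≡⟨ cong ((b ∸ m) *_) (nCk+nC[k+1]≡[n+1]C[k+1] b m) ⟩
    (b ∸ m) * (suc b C suc m) ∎
    where
    open ≡-Reasoning
    regroup : ∀ m d x → suc (suc m) * x + d * x ≡ suc d * x + suc m * x
    regroup = solve-∀
    shift : suc (suc m) * (b C suc m) + (b ∸ suc m) * (b C suc m)
          ≡ (b ∸ m) * (b C suc m) + suc m * (b C suc m)
    -- For `m < b` a single unit moves between the two factors, as `b ∸ m` is `suc (b ∸ suc m)`;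
    -- otherwise `b C suc m` is zero.
    shift with m <? b
    ... | yes m<b = trans (regroup m (b ∸ suc m) (b C suc m))
      (cong (λ d → d * (b C suc m) + suc m * (b C suc m)) (sym (+-∸-assoc 1 m<b)))
    ... | no m≮b rewrite k>n⇒nCk≡0 {b} {suc m} (s≤s (≮⇒≥ m≮b)) =
      trans (zeros (suc (suc m)) (b ∸ suc m)) (sym (zeros (b ∸ m) (suc m)))
      where
      zeros : ∀ x y → x * 0 + y * 0 ≡ 0
      zeros x y = cong₂ _+_ (*-zeroʳ x) (*-zeroʳ y)

  ∑-distinct-columns : ∀ l m → ∑ᵛ (cube l) m (λ M → 𝟙 (distinct (columns M))) ≡ (m !) * ((2 ^ l ∸ 1) C m)
  ∑-distinct-columns l zero    = refl
  ∑-distinct-columns l (suc m) = begin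
    ∑ (cube l) (λ c → ∑ᵛ (cube l) m (λ M → 𝟙 (distinct (columns (c ∷ M)))))
      ≡⟨ ∑-∑ᵛ-swap (cube l) (cube l) m (λ c M → 𝟙 (distinct (columns (c ∷ M)))) ⟩
    ∑ᵛ (cube l) m (λ M → ∑ (cube l) (λ c → 𝟙 (distinct (columns (c ∷ M)))))
      ≡⟨ ∑ᵛ-cong (cube l) m (λ M →
           trans (∑-cong (λ c → cong 𝟙 (distinct-swap (replicate l false) c M)) (cube l))
             (∑-distinct-∷ (columns M))) ⟩
    ∑ᵛ (cube l) m (λ M → (2 ^ l ∸ suc m) * 𝟙 (distinct (columns M)))
      ≡⟨ *-distribˡ-∑ᵛ (cube l) m (2 ^ l ∸ suc m) _ ⟩
    (2 ^ l ∸ suc m) * ∑ᵛ (cube l) m (λ M → 𝟙 (distinct (columns M)))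
      -- The `suc m` forbidden values are the zero column and `m` earlier ones; splitting off the
      -- former gives the upper index `2 ^ l ∸ 1` of the binomial.
      ≡⟨ cong₂ _*_ (sym (∸-+-assoc (2 ^ l) 1 m)) (∑-distinct-columns l m) ⟩
    (2 ^ l ∸ 1 ∸ m) * ((m !) * ((2 ^ l ∸ 1) C m))
      ≡⟨ x∙yz≈y∙xz (2 ^ l ∸ 1 ∸ m) (m !) _ ⟩
    (m !) * ((2 ^ l ∸ 1 ∸ m) * ((2 ^ l ∸ 1) C m))
      ≡⟨ cong ((m !) *_) (sym (absorption (2 ^ l ∸ 1) m)) ⟩
    (m !) * (suc m * ((2 ^ l ∸ 1) C suc m))
      ≡⟨ x∙yz≈yx∙z (m !) (suc m) _ ⟩
    (suc m !) * ((2 ^ l ∸ 1) C suc m) ∎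
    where
    open ≡-Reasoning

  adjoin^-separates : ∀ {m} l → adjoin^ {m} l (𝟙 ∘ separates) none ≡ (m !) * ((2 ^ l ∸ 1) C m)
  adjoin^-separates {m} l = begin
    adjoin^ l (𝟙 ∘ separates) none
      ≡⟨ adjoin^-columns l (𝟙 ∘ separates) separates-ext none ⟩
    ∑ᵛ (cube l) m (λ M → 𝟙 (separates (none ∪ columnCut M)))
      ≡⟨ ∑ᵛ-cong (cube l) m (λ M → cong 𝟙 (separates-columns M)) ⟩
    ∑ᵛ (cube l) m (λ M → 𝟙 (distinct (columns M)))
      ≡⟨ ∑-distinct-columns l m ⟩
    (m !) * ((2 ^ l ∸ 1) C m) ∎
    where open ≡-Reasoning

  -- Counting through duplicate-free lists

  unique-↭ : {A : Set} {xs ys : List A} → Unique xs → Unique ys → (∀ x → x ∈ xs ⇔ x ∈ ys) → xs ↭ ys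
  unique-↭ u u′ same = ∼bag⇒↭ (unique∧set⇒bag u u′ (λ {x} → same x))

  T-anyF : ∀ n (p : Fin n → Bool) → T (anyF n p) ⇔ (∃[ i ] T (p i))
  T-anyF n p = mk⇔ ⇒ (λ (i , pi) → Any.any⁺ p (lose (∈-allFin i) pi))
    where
    ⇒ : T (anyF n p) → ∃[ i ] T (p i)
    ⇒ h with i , _ , pi ← find (Any.any⁻ p (allFin n) h) = i , pi

  module _ {N : ℕ} (p : Fin N → Bool) where

    satisfying : List (Fin N)
    satisfying = filterᵇ p (allFin N)

    unique-satisfying : Unique satisfying
    unique-satisfying = Unique.filter⁺ (T? ∘ p) (Unique.allFin⁺ N)

    ∈-satisfying : ∀ j → j ∈ satisfying ⇔ T (p j)
    ∈-satisfying j = mk⇔ (λ h → proj₂ (∈-filter⁻ (T? ∘ p) {xs = allFin N} h))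
                         (λ h → ∈-filter⁺ (T? ∘ p) (∈-allFin j) h)

    countF-enumerated : (ys : List (Fin N)) → Unique ys → (∀ j → T (p j) ⇔ j ∈ ys) → countF N p ≡ length ys
    countF-enumerated ys u h = Permutation.↭-length (unique-↭ unique-satisfying u
      (λ j → mk⇔ (to (h j) ∘ to (∈-satisfying j)) (from (∈-satisfying j) ∘ from (h j))))

    -- By definition `countF N p` is the length of `satisfying`, so the hypothesis leaves a single
    -- shape for that list.
    countF-1 : countF N p ≡ 1 → ∃[ i ] T (p i) × (∀ j → T (p j) → j ≡ i)
    countF-1 eq with satisfying | ∈-satisfying
    ... | i ∷ [] | member = i , to (member i) (here refl) , only
      where
      only : ∀ j → T (p j) → j ≡ i
      only j pj with from (member j) pj
      ... | here j≡i = j≡i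

    countF-2 : countF N p ≡ 2 → ∃₂ λ i i′ → i ≢ i′ × T (p i) × T (p i′) × (∀ j → T (p j) → j ≡ i ⊎ j ≡ i′)
    countF-2 eq with satisfying | unique-satisfying | ∈-satisfying
    ... | i ∷ i′ ∷ [] | (i≢i′ All.∷ All.[]) ∷ _ | member =
      i , i′ , i≢i′ , to (member i) (here refl) , to (member i′) (there (here refl)) , only
      where
      only : ∀ j → T (p j) → j ≡ i ⊎ j ≡ i′
      only j pj with from (member j) pj
      ... | here j≡i          = inj₁ j≡i
      ... | there (here j≡i′) = inj₂ j≡i′

  -- The enumeration of the cube

  ∈-cube : ∀ {n} (A : Vec Bool n) → A ∈ cube n
  ∈-cube []          = here refl
  ∈-cube {suc n} (true ∷ A)  =
    subst (true ∷ A ∈_) (sym (cube-suc n)) (∈-++⁺ˡ (∈-map⁺ (true ∷_) (∈-cube A)))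
  ∈-cube {suc n} (false ∷ A) =
    subst (false ∷ A ∈_) (sym (cube-suc n)) (∈-++⁺ʳ (map (true ∷_) (cube n)) (∈-map⁺ (false ∷_) (∈-cube A)))

  unique-cube : ∀ n → Unique (cube n)
  unique-cube zero    = All.[] ∷ []
  unique-cube (suc n) = subst Unique (sym (cube-suc n))
    (Unique.++⁺ (Unique.map⁺ ∷-injectiveʳ (unique-cube n)) (Unique.map⁺ ∷-injectiveʳ (unique-cube n)) disjoint)
    where
    disjoint : ∀ {x} → x ∈ map (true ∷_) (cube n) × x ∈ map (false ∷_) (cube n) → ⊥
    disjoint (h , h′) with ∈-map⁻ (true ∷_) h | ∈-map⁻ (false ∷_) h′
    ... | _ , _ , refl | _ , _ , ()

  lookup-injective : {A : Set} {n : ℕ} (v : Vec A n) → Unique (toList v) → ∀ i j → lookup v i ≡ lookup v j → i ≡ j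
  lookup-injective (x ∷ v) _ zero zero _ = refl
  lookup-injective (x ∷ v) (x∉v ∷ _) zero (suc j) eq =
    contradiction eq (All.lookup x∉v (Vec.∈-toList⁺ (Vec.∈-lookup j v)))
  lookup-injective (x ∷ v) (x∉v ∷ _) (suc i) zero eq =
    contradiction (sym eq) (All.lookup x∉v (Vec.∈-toList⁺ (Vec.∈-lookup i v)))
  lookup-injective (x ∷ v) (_ ∷ u) (suc i) (suc j) eq = cong suc (lookup-injective v u i j eq)

  ∈-toList-lookup : {A : Set} {n : ℕ} (v : Vec A n) {x : A} → x ∈ toList v → ∃[ i ] lookup v i ≡ x
  ∈-toList-lookup (y ∷ v) (here refl) = zero , refl
  ∈-toList-lookup (y ∷ v) (there h) with i , eq ← ∈-toList-lookup v h = suc i , eq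

  blk-injective : ∀ {n} i j → blk {n} i ≡ blk {n} j → i ≡ j
  blk-injective {n} = lookup-injective (subsets n) (unique-cube n)

  blk-surjective : ∀ {n} (A : Sub n) → ∃[ j ] blk {n} j ≡ A
  blk-surjective {n} A = ∈-toList-lookup (subsets n) (∈-cube A)

  lookup-ext : ∀ {n} (A B : Vec Bool n) → (∀ i → lookup A i ≡ lookup B i) → A ≡ B
  lookup-ext A B eq = trans (sym (tabulate∘lookup A)) (trans (tabulate-cong eq) (tabulate∘lookup B))

  T-differ : ∀ {l} (x y : Vec Bool l) → T (not (differ x y)) ⇔ x ≡ y
  T-differ x y = mk⇔ (⇒ x y) (λ { refl → from T-not-≡ (differ-refl x) })
    where
    ⇒ : ∀ {l} (x y : Vec Bool l) → T (not (differ x y)) → x ≡ y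
    ⇒ []          []          _ = refl
    ⇒ (true ∷ x)  (true ∷ y)  h = cong (true ∷_) (⇒ x y h)
    ⇒ (false ∷ x) (false ∷ y) h = cong (false ∷_) (⇒ x y h)

  -- Proper bipartitions and nonzero bit vectors

  module _ {m : ℕ} (v : Vec Bool m) where

    -- `off` consists of the elements cut from `zero`; `on` is the component of `zero`.
    off on : Sub (suc m)
    off = false ∷ v
    on  = true ∷ Vec.map not v

    bipartition : Coll (suc m)
    bipartition = tabulate (λ j → not (differ (blk j) off) ∨ not (differ (blk j) on))

    lookup-on : ∀ i → lookup on i ≡ not (lookup off i)
    lookup-on zero    = refl
    lookup-on (suc i) = lookup-map i not v

    ∈-bipartition : ∀ j → T (lookup bipartition j) ⇔ (blk j ≡ off ⊎ blk j ≡ on)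
    ∈-bipartition j = mk⇔ ⇒ ⇐
      where
      unfold = lookup∘tabulate (λ j → not (differ (blk {suc m} j) off) ∨ not (differ (blk j) on)) j
      ⇒ : T (lookup bipartition j) → blk j ≡ off ⊎ blk j ≡ on
      ⇒ h with to (T-∨ {not (differ (blk j) off)}) (subst T unfold h)
      ... | inj₁ e = inj₁ (to (T-differ _ _) e)
      ... | inj₂ e = inj₂ (to (T-differ _ _) e)
      ⇐ : blk j ≡ off ⊎ blk j ≡ on → T (lookup bipartition j)
      ⇐ (inj₁ e) = subst T (sym unfold) (from (T-∨ {not (differ (blk j) off)}) (inj₁ (from (T-differ _ _) e)))
      ⇐ (inj₂ e) = subst T (sym unfold) (from (T-∨ {not (differ (blk j) off)}) (inj₂ (from (T-differ _ _) e)))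

    offIndex onIndex : Fin (2 ^ suc m)
    offIndex = proj₁ (blk-surjective off)
    onIndex  = proj₁ (blk-surjective on)

    blk-offIndex : blk offIndex ≡ off
    blk-offIndex = proj₂ (blk-surjective off)

    blk-onIndex : blk onIndex ≡ on
    blk-onIndex = proj₂ (blk-surjective on)

    offIndex≢onIndex : offIndex ≢ onIndex
    offIndex≢onIndex eq with () ← trans (sym blk-offIndex) (trans (cong (blk {suc m}) eq) blk-onIndex)

    offIndex-∈ : T (lookup bipartition offIndex)
    offIndex-∈ = from (∈-bipartition offIndex) (inj₁ blk-offIndex)

    onIndex-∈ : T (lookup bipartition onIndex)
    onIndex-∈ = from (∈-bipartition onIndex) (inj₂ blk-onIndex)

    members : ∀ j → T (lookup bipartition j) → j ≡ offIndex ⊎ j ≡ onIndex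
    members j h with to (∈-bipartition j) h
    ... | inj₁ e = inj₁ (blk-injective j offIndex (trans e (sym blk-offIndex)))
    ... | inj₂ e = inj₂ (blk-injective j onIndex (trans e (sym blk-onIndex)))

    -- The component `on` contains `zero`, so only `off` could be empty; this is where `v` has to be
    -- nonzero.
    bipartition-nonempty : T (nonemptyᵇ v) → ∀ j → T (not (lookup bipartition j) ∨ nonemptyᵇ (blk {suc m} j))
    bipartition-nonempty ne j with lookup bipartition j in eq
    ... | false = tt
    ... | true with to (∈-bipartition j) (subst T (sym eq) tt) | to (T-anyF m _) ne
    ... | inj₁ e | i , vi = from (T-anyF (suc m) _) (suc i , subst (λ A → T (lookup A (suc i))) (sym e) vi)
    ... | inj₂ e | _      = from (T-anyF (suc m) _) (zero , subst (λ A → T (lookup A zero)) (sym e) tt)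

    bipartition-covers : ∀ i → countF (2 ^ suc m) (λ j → lookup bipartition j ∧ lookup (blk {suc m} j) i) ≡ 1
    bipartition-covers i = by (lookup off i) refl
      where
      p : Fin (2 ^ suc m) → Bool
      p j = lookup bipartition j ∧ lookup (blk {suc m} j) i

      -- The component containing i has index c, the other one index d.
      count : ∀ c d → T (lookup bipartition c) → T (lookup (blk {suc m} c) i) → ¬ T (lookup (blk {suc m} d) i) →
        (∀ j → T (lookup bipartition j) → j ≡ c ⊎ j ≡ d) → countF (2 ^ suc m) p ≡ 1
      count c d c∈ i∈c i∉d only = countF-enumerated p (c ∷ []) (All.[] ∷ []) (λ j → mk⇔ (⇒ j) (⇐ j))
        where
        ⇒ : ∀ j → T (p j) → j ∈ c ∷ []
        ⇒ j h with only j (proj₁ (to T-∧ h))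
        ... | inj₁ refl = here refl
        ... | inj₂ refl = contradiction (proj₂ (to (T-∧ {lookup bipartition j}) h)) i∉d
        ⇐ : ∀ j → j ∈ c ∷ [] → T (p j)
        ⇐ j (here refl) = from T-∧ (c∈ , i∈c)

      by : ∀ b → lookup off i ≡ b → countF (2 ^ suc m) p ≡ 1
      by true  eq = count offIndex onIndex offIndex-∈
        (subst T (sym (trans (cong (λ A → lookup A i) blk-offIndex) eq)) tt)
        (subst T (trans (cong (λ A → lookup A i) blk-onIndex) (trans (lookup-on i) (cong not eq))))
        members
      by false eq = count onIndex offIndex onIndex-∈
        (subst T (sym (trans (cong (λ A → lookup A i) blk-onIndex) (trans (lookup-on i) (cong not eq)))) tt)
        (subst T (trans (cong (λ A → lookup A i) blk-offIndex) eq))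
        (λ j h → Sum.swap (members j h))

    bipartition-size : countF (2 ^ suc m) (λ j → lookup bipartition j) ≡ 2
    bipartition-size = countF-enumerated (lookup bipartition) (offIndex ∷ onIndex ∷ [])
      ((offIndex≢onIndex All.∷ All.[]) ∷ (All.[] ∷ [])) (λ j → mk⇔ (⇒ j) (⇐ j))
      where
      ⇒ : ∀ j → T (lookup bipartition j) → j ∈ offIndex ∷ onIndex ∷ []
      ⇒ j h with members j h
      ... | inj₁ e = here e
      ... | inj₂ e = there (here e)
      ⇐ : ∀ j → j ∈ offIndex ∷ onIndex ∷ [] → T (lookup bipartition j)
      ⇐ j (here refl)         = offIndex-∈
      ⇐ j (there (here refl)) = onIndex-∈

    bipartition-proper : T (nonemptyᵇ v) → T (isProperBipartitionᵇ {suc m} bipartition)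
    bipartition-proper ne = from T-∧
      ( from T-∧
        ( from (T-allF (2 ^ suc m) _) (bipartition-nonempty ne)
        , from (T-allF (suc m) _) (λ i → ≡⇒≡ᵇ _ 1 (bipartition-covers i)))
      , ≡⇒≡ᵇ _ 2 bipartition-size)

    -- `cutsᵇ` asks for a component with `a` but without `b`: `off` detects the bits `true`, `false`
    -- and `on` the bits `false`, `true`, together the `xor`.
    cuts-bipartition : cutsᵇ {suc m} bipartition ≈ bitCut v
    cuts-bipartition a b = T-extensional _ _ ⇒ ⇐
      where
      cutBy : Fin (2 ^ suc m) → Bool
      cutBy j = lookup bipartition j ∧ lookup (blk {suc m} j) a ∧ not (lookup (blk {suc m} j) b)

      separated : ∀ x y → T (x ∧ not y) → T (x xor y)
      separated true y h = h

      separated-not : ∀ x y → T (not x ∧ not (not y)) → T (x xor y)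
      separated-not false true h = tt

      ⇒ : T (cutsᵇ {suc m} bipartition a b) → T (bitCut v a b)
      ⇒ h with j , hj ← to (T-anyF (2 ^ suc m) cutBy) h
        with j∈ , ab ← to (T-∧ {lookup bipartition j}) hj with to (∈-bipartition j) j∈
      ... | inj₁ e = separated (lookup off a) (lookup off b)
        (subst (λ A → T (lookup A a ∧ not (lookup A b))) e ab)
      ... | inj₂ e = separated-not (lookup off a) (lookup off b)
        (subst (λ x → T (x ∧ not (not (lookup off b)))) (lookup-on a)
          (subst (λ y → T (lookup on a ∧ not y)) (lookup-on b)
            (subst (λ A → T (lookup A a ∧ not (lookup A b))) e ab)))

      witness : ∀ j A → T (lookup bipartition j) → blk {suc m} j ≡ A → T (lookup A a ∧ not (lookup A b)) →
        T (cutsᵇ {suc m} bipartition a b)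
      witness j A j∈ e h = from (T-anyF (2 ^ suc m) cutBy)
        (j , from T-∧ (j∈ , subst (λ A → T (lookup A a ∧ not (lookup A b))) (sym e) h))

      by : ∀ x y → lookup off a ≡ x → lookup off b ≡ y → T (x xor y) → T (cutsᵇ {suc m} bipartition a b)
      by true  false ea eb _ = witness offIndex off offIndex-∈ blk-offIndex
        (subst T (sym (cong₂ (λ x y → x ∧ not y) ea eb)) tt)
      by false true  ea eb _ = witness onIndex on onIndex-∈ blk-onIndex
        (subst T (sym (cong₂ (λ x y → x ∧ not y)
          (trans (lookup-on a) (cong not ea)) (trans (lookup-on b) (cong not eb)))) tt)

      ⇐ : T (bitCut v a b) → T (cutsᵇ {suc m} bipartition a b)
      ⇐ = by _ _ refl refl

  -- The vector is read off from the component avoiding `zero`, which cannot coincide with `on w`.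
  bipartition-injective : ∀ {m} {v w : Vec Bool m} → bipartition v ≡ bipartition w → v ≡ w
  bipartition-injective {m} {v} {w} eq
    with to (∈-bipartition w (offIndex v)) (subst (λ K → T (lookup K (offIndex v))) eq (offIndex-∈ v))
  ... | inj₁ e = ∷-injectiveʳ (trans (sym (blk-offIndex v)) e)
  ... | inj₂ e with () ← trans (sym (blk-offIndex v)) e

  module _ {m : ℕ} (K : Coll (suc m)) where

    two-blocks : ∀ i i′ v → (∀ j → T (lookup K j) → j ≡ i ⊎ j ≡ i′) → T (lookup K i) → T (lookup K i′) →
      blk {suc m} i ≡ off v → blk {suc m} i′ ≡ on v → K ≡ bipartition v
    two-blocks i i′ v only i∈ i′∈ ei ei′ = lookup-ext K (bipartition v)
      (λ j → T-extensional _ _ (from (∈-bipartition v j) ∘ ⇒ j) (⇐ j ∘ to (∈-bipartition v j)))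
      where
      ⇒ : ∀ j → T (lookup K j) → blk j ≡ off v ⊎ blk j ≡ on v
      ⇒ j h with only j h
      ... | inj₁ refl = inj₁ ei
      ... | inj₂ refl = inj₂ ei′
      ⇐ : ∀ j → blk j ≡ off v ⊎ blk j ≡ on v → T (lookup K j)
      ⇐ j (inj₁ e) = subst (T ∘ lookup K) (blk-injective i j (trans ei (sym e))) i∈
      ⇐ j (inj₂ e) = subst (T ∘ lookup K) (blk-injective i′ j (trans ei′ (sym e))) i′∈

    proper⇒bipartition : T (isProperBipartitionᵇ {suc m} K) → ∃[ v ] T (nonemptyᵇ v) × K ≡ bipartition v
    proper⇒bipartition proper = choose (countF-2 (lookup K) (≡ᵇ⇒≡ _ 2 (proj₂ parts)))
      where
      parts = to (T-∧ {isPartitionᵇ {suc m} K}) proper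
      parts′ = to (T-∧ {allF (2 ^ suc m) (λ j → not (lookup K j) ∨ nonemptyᵇ (blk {suc m} j))}) (proj₁ parts)

      nonempty : ∀ j → T (lookup K j) → T (nonemptyᵇ (blk {suc m} j))
      nonempty j j∈ with lookup K j | to (T-allF (2 ^ suc m) _) (proj₁ parts′) j
      ... | true | h = h

      exactly : ∀ i → ∃[ c ] T (lookup K c ∧ lookup (blk {suc m} c) i)
        × (∀ j → T (lookup K j ∧ lookup (blk {suc m} j) i) → j ≡ c)
      exactly i = countF-1 (λ j → lookup K j ∧ lookup (blk {suc m} j) i)
        (≡ᵇ⇒≡ _ 1 (to (T-allF (suc m) _) (proj₂ parts′) i))

      module _ (c d : Fin (2 ^ suc m)) (c≢d : c ≢ d) (c∈ : T (lookup K c)) (d∈ : T (lookup K d))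
        (only : ∀ j → T (lookup K j) → j ≡ c ⊎ j ≡ d) where

        complementary : ∀ i → lookup (blk {suc m} d) i ≡ not (lookup (blk {suc m} c) i)
        complementary i = T-extensional _ _ ⇒ ⇐
          where
          ⇒ : T (lookup (blk {suc m} d) i) → T (not (lookup (blk {suc m} c) i))
          ⇒ i∈d with lookup (blk {suc m} c) i in eq
          ... | false = tt
          -- An element of both blocks would force them to be equal, since only one block passes
          -- through it.
          ... | true with _ , _ , same ← exactly i = c≢d
            (trans (same c (from T-∧ (c∈ , subst T (sym eq) tt))) (sym (same d (from T-∧ (d∈ , i∈d)))))
          ⇐ : T (not (lookup (blk {suc m} c) i)) → T (lookup (blk {suc m} d) i)
          ⇐ i∉c with e , h , _ ← exactly i with e∈ , i∈e ← to (T-∧ {lookup K e}) h with only e e∈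
          ... | inj₂ refl = i∈e
          ... | inj₁ refl with lookup (blk {suc m} c) i
          ... | true = ⊥-elim i∉c

        result : ∀ A → blk {suc m} c ≡ A → lookup A zero ≡ false → ∃[ v ] T (nonemptyᵇ v) × K ≡ bipartition v
        result (false ∷ v) ec refl = v , ne , two-blocks c d v only c∈ d∈ ec
          (lookup-ext (blk d) (on v) (λ i → trans (complementary i)
            (trans (cong (λ A → not (lookup A i)) ec) (sym (lookup-on v i)))))
          where
          ne : T (nonemptyᵇ v)
          ne = subst T (anyF-suc m (lookup (false ∷ v))) (subst (T ∘ nonemptyᵇ) ec (nonempty c c∈))

      choose : (∃₂ λ i i′ → i ≢ i′ × T (lookup K i) × T (lookup K i′) × (∀ j → T (lookup K j) → j ≡ i ⊎ j ≡ i′)) →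
        ∃[ v ] T (nonemptyᵇ v) × K ≡ bipartition v
      -- The two blocks come in arbitrary order; the one avoiding `zero` takes the role of `off`.
      choose (i , i′ , i≢i′ , i∈ , i′∈ , only) with lookup (blk {suc m} i) zero in eq
      ... | false = result i i′ i≢i′ i∈ i′∈ only (blk i) refl eq
      ... | true  = result i′ i (i≢i′ ∘ sym) i′∈ i∈ (λ j h → Sum.swap (only j h)) (blk i′) refl
        (trans (complementary i i′ i≢i′ i∈ i′∈ only zero) (cong not eq))

  proper-↭ : ∀ m → filterᵇ (isProperBipartitionᵇ {suc m}) (cube (2 ^ suc m))
                 ↭ map bipartition (filterᵇ nonemptyᵇ (cube m))
  proper-↭ m = unique-↭
    (Unique.filter⁺ (T? ∘ isProperBipartitionᵇ {suc m}) (unique-cube (2 ^ suc m)))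
    (Unique.map⁺ bipartition-injective (Unique.filter⁺ (T? ∘ nonemptyᵇ) (unique-cube m)))
    (λ K → mk⇔ (⇒ K) (⇐ K))
    where
    ⇒ : ∀ K → K ∈ filterᵇ (isProperBipartitionᵇ {suc m}) (cube (2 ^ suc m)) →
      K ∈ map bipartition (filterᵇ nonemptyᵇ (cube m))
    ⇒ K h with v , ne , refl ← proper⇒bipartition {m} K
          (proj₂ (∈-filter⁻ (T? ∘ isProperBipartitionᵇ {suc m}) {xs = cube (2 ^ suc m)} h)) =
      ∈-map⁺ bipartition (∈-filter⁺ (T? ∘ nonemptyᵇ) (∈-cube v) ne)
    ⇐ : ∀ K → K ∈ map bipartition (filterᵇ nonemptyᵇ (cube m)) →
      K ∈ filterᵇ (isProperBipartitionᵇ {suc m}) (cube (2 ^ suc m))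
    ⇐ K h with v , v∈ , refl ← ∈-map⁻ (bipartition {m}) h =
      ∈-filter⁺ (T? ∘ isProperBipartitionᵇ {suc m}) (∈-cube (bipartition v))
        (bipartition-proper v (proj₂ (∈-filter⁻ (T? ∘ nonemptyᵇ) {xs = cube m} v∈)))

  ∑-nonempty : ∀ m (f : Vec Bool m → ℕ) →
    ∑ (cube m) (λ v → 𝟙 (nonemptyᵇ v) * f v) + f (replicate m false) ≡ ∑ (cube m) f
  ∑-nonempty zero    f = sym (+-identityʳ (f []))
  ∑-nonempty (suc m) f = begin
    ∑ (cube (suc m)) (λ v → 𝟙 (nonemptyᵇ v) * f v) + f (false ∷ replicate m false)
      ≡⟨ cong (_+ f (false ∷ replicate m false)) (∑-cube-suc m _) ⟩
    ∑ (cube m) (λ v → 𝟙 (nonemptyᵇ (true ∷ v)) * f (true ∷ v))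
      + ∑ (cube m) (λ v → 𝟙 (nonemptyᵇ (false ∷ v)) * f (false ∷ v)) + f (false ∷ replicate m false)
      ≡⟨ +-assoc (∑ (cube m) (λ v → 𝟙 (nonemptyᵇ (true ∷ v)) * f (true ∷ v))) _ _ ⟩
    ∑ (cube m) (λ v → 1 * f (true ∷ v))
      + (∑ (cube m) (λ v → 𝟙 (nonemptyᵇ (false ∷ v)) * f (false ∷ v)) + f (false ∷ replicate m false))
      ≡⟨ cong₂ _+_ (∑-cong (λ v → +-identityʳ (f (true ∷ v))) (cube m))
           (trans (cong (_+ f (false ∷ replicate m false))
               (∑-cong (λ v → cong (λ b → 𝟙 b * f (false ∷ v)) (anyF-suc m (lookup (false ∷ v)))) (cube m)))
             (∑-nonempty m (f ∘ (false ∷_)))) ⟩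
    ∑ (cube m) (f ∘ (true ∷_)) + ∑ (cube m) (f ∘ (false ∷_))
      ≡⟨ sym (∑-cube-suc m f) ⟩
    ∑ (cube (suc m)) f ∎
    where open ≡-Reasoning

  -- Proper bipartitions correspond to the nonzero vectors; the term `Ψ none` of the trivial one
  -- fills in the zero vector and completes the cube.
  ∑-proper : ∀ m (Ψ : Cut (suc m) → ℕ) → Extensional Ψ →
    ∑ (cube (2 ^ suc m)) (λ K → 𝟙 (isProperBipartitionᵇ {suc m} K) * Ψ (cutsᵇ {suc m} K)) + Ψ none
      ≡ ∑ (cube m) (Ψ ∘ bitCut)
  ∑-proper m Ψ ext = begin
    ∑ (cube (2 ^ suc m)) (λ K → 𝟙 (isProperBipartitionᵇ {suc m} K) * Ψ (cutsᵇ {suc m} K)) + Ψ none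
      ≡⟨ cong (_+ Ψ none) (sym (∑-filterᵇ (isProperBipartitionᵇ {suc m})
           (λ K → Ψ (cutsᵇ {suc m} K)) (cube (2 ^ suc m)))) ⟩
    ∑ (filterᵇ (isProperBipartitionᵇ {suc m}) (cube (2 ^ suc m))) (λ K → Ψ (cutsᵇ {suc m} K)) + Ψ none
      ≡⟨ cong (_+ Ψ none) (∑-↭ _ (proper-↭ m)) ⟩
    ∑ (map bipartition (filterᵇ nonemptyᵇ (cube m))) (λ K → Ψ (cutsᵇ {suc m} K)) + Ψ none
      ≡⟨ cong (_+ Ψ none) (∑-map _ bipartition (filterᵇ nonemptyᵇ (cube m))) ⟩
    ∑ (filterᵇ nonemptyᵇ (cube m)) (λ v → Ψ (cutsᵇ {suc m} (bipartition v))) + Ψ none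
      ≡⟨ cong₂ _+_ (trans (∑-cong (λ v → ext (cuts-bipartition v)) (filterᵇ nonemptyᵇ (cube m)))
           (∑-filterᵇ nonemptyᵇ (Ψ ∘ bitCut) (cube m)))
           (ext (λ a b → sym (bitCut-replicate a b))) ⟩
    ∑ (cube m) (λ v → 𝟙 (nonemptyᵇ v) * Ψ (bitCut v)) + Ψ (bitCut (replicate m false))
      ≡⟨ ∑-nonempty m (Ψ ∘ bitCut) ⟩
    ∑ (cube m) (Ψ ∘ bitCut) ∎
    where open ≡-Reasoning

  -- The recurrence for separating families

  -- When `x` already belongs to `F`, the extra disjunct is absorbed by idempotence.
  any-insert : ∀ {n} (q : Fin n → Bool) x F →
    anyF n (λ t → lookup (insert x F) t ∧ q t) ≡ anyF n (λ t → lookup F t ∧ q t) ∨ q x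
  any-insert {suc n} q zero (b ∷ F) = begin
    anyF (suc n) (λ t → lookup (true ∷ F) t ∧ q t)        ≡⟨ anyF-suc n _ ⟩
    q zero ∨ rest                                         ≡⟨ absorb b (q zero) rest ⟩
    ((b ∧ q zero) ∨ rest) ∨ q zero                        ≡⟨ cong (_∨ q zero) (sym (anyF-suc n _)) ⟩
    anyF (suc n) (λ t → lookup (b ∷ F) t ∧ q t) ∨ q zero  ∎
    where
    open ≡-Reasoning
    rest = anyF n (λ t → lookup F t ∧ q (suc t))
    absorb : ∀ b c r → c ∨ r ≡ ((b ∧ c) ∨ r) ∨ c
    absorb true  true  r     = refl
    absorb false true  true  = refl
    absorb false true  false = refl
    absorb true  false r     = sym (∨-identityʳ r)
    absorb false false r     = sym (∨-identityʳ r)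
  any-insert {suc n} q (suc x) (b ∷ F) = begin
    anyF (suc n) (λ t → lookup (b ∷ insert x F) t ∧ q t)
      ≡⟨ anyF-suc n _ ⟩
    (b ∧ q zero) ∨ anyF n (λ t → lookup (insert x F) t ∧ q (suc t))
      ≡⟨ cong ((b ∧ q zero) ∨_) (any-insert (q ∘ suc) x F) ⟩
    (b ∧ q zero) ∨ (anyF n (λ t → lookup F t ∧ q (suc t)) ∨ q (suc x))
      ≡⟨ sym (∨-assoc (b ∧ q zero) _ _) ⟩
    ((b ∧ q zero) ∨ anyF n (λ t → lookup F t ∧ q (suc t))) ∨ q (suc x)
      ≡⟨ cong (_∨ q (suc x)) (sym (anyF-suc n _)) ⟩
    anyF (suc n) (λ t → lookup (b ∷ F) t ∧ q t) ∨ q (suc x) ∎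
    where open ≡-Reasoning

  any-empty : ∀ n (q : Fin n → Bool) → anyF n (λ t → lookup (replicate n false) t ∧ q t) ≡ false
  any-empty zero    q = refl
  any-empty (suc n) q = trans (anyF-suc n (λ t → lookup (replicate (suc n) false) t ∧ q t)) (any-empty n (q ∘ suc))

  module _ (m : ℕ) where

    candidates : ℕ
    candidates = 2 ^ (2 ^ suc m)

    proper : Fin candidates → Bool
    proper t = isProperBipartitionᵇ {suc m} (coll {suc m} t)

    familyCut : Family (suc m) → Cut (suc m)
    familyCut F a b = anyF candidates (λ t → lookup F t ∧ cutsᵇ {suc m} (coll {suc m} t) a b)

    familyCut-insert : ∀ t F → familyCut (insert t F) ≈ familyCut F ∪ cutsᵇ {suc m} (coll {suc m} t)
    familyCut-insert t F a b = any-insert (λ t → cutsᵇ {suc m} (coll {suc m} t) a b) t F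

    -- The result again depends on `F` only through its cut relation, which is what allows the
    -- operator to be iterated.
    ∑-proper-insert : (Ψ : Cut (suc m) → ℕ) → Extensional Ψ → ∀ F →
      ∑ (allFin candidates) (λ t → 𝟙 (proper t) * Ψ (familyCut (insert t F))) + Ψ (familyCut F)
        ≡ adjoin Ψ (familyCut F)
    ∑-proper-insert Ψ ext F = begin
      ∑ (allFin candidates) (λ t → 𝟙 (proper t) * Ψ (familyCut (insert t F))) + Ψ (familyCut F)
        ≡⟨ cong₂ _+_
             (∑-cong (λ t → cong (𝟙 (proper t) *_) (ext (familyCut-insert t F))) (allFin candidates))
             (ext (λ a b → sym (∨-identityʳ (familyCut F a b)))) ⟩
      ∑ (allFin candidates) (λ t → 𝟙 (proper t) * Ψ (familyCut F ∪ cutsᵇ {suc m} (coll {suc m} t)))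
        + Ψ (familyCut F ∪ none)
        ≡⟨ cong (_+ Ψ (familyCut F ∪ none)) (∑-allFin-lookup
             (λ K → 𝟙 (isProperBipartitionᵇ {suc m} K) * Ψ (familyCut F ∪ cutsᵇ {suc m} K))
             (subsets (2 ^ suc m))) ⟩
      ∑ (cube (2 ^ suc m)) (λ K → 𝟙 (isProperBipartitionᵇ {suc m} K) * Ψ (familyCut F ∪ cutsᵇ {suc m} K))
        + Ψ (familyCut F ∪ none)
        ≡⟨ ∑-proper m (λ S → Ψ (familyCut F ∪ S))
             (λ R≈S → ext (∪-cong {R = familyCut F} (λ _ _ → refl) R≈S)) ⟩
      adjoin Ψ (familyCut F) ∎
      where open ≡-Reasoning

    -- k! times the number of pairs of a family F of k proper bipartitions and a sequence of i
    -- bipartitions, not necessarily proper or distinct, that separate together with F.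
    mixed : ℕ → ℕ → ℕ
    mixed k i = (k !) * ∑-kSubsets proper k (adjoin^ i (𝟙 ∘ separates) ∘ familyCut)

    mixed-zero : ∀ i → mixed 0 i ≡ (m !) * ((2 ^ i ∸ 1) C m)
    mixed-zero i = begin
      1 * ∑-kSubsets proper 0 (adjoin^ i (𝟙 ∘ separates) ∘ familyCut)
        ≡⟨ *-identityˡ _ ⟩
      ∑-kSubsets proper 0 (adjoin^ i (𝟙 ∘ separates) ∘ familyCut)
        ≡⟨ ∑-kSubsets-zero proper (adjoin^ i (𝟙 ∘ separates) ∘ familyCut) ⟩
      adjoin^ i (𝟙 ∘ separates) (familyCut (replicate candidates false))
        ≡⟨ adjoin^-ext i separates-ext (λ a b → any-empty candidates _) ⟩
      adjoin^ i (𝟙 ∘ separates) none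
        ≡⟨ adjoin^-separates i ⟩
      (m !) * ((2 ^ i ∸ 1) C m) ∎
      where open ≡-Reasoning

    -- The first of the `suc i` adjoined bipartitions is merged into the family. The factor `k !` in
    -- `mixed` absorbs the `suc k` ways in which an enlarged family arises.
    mixed-suc : ∀ k i → mixed k (suc i) ≡ suc k * mixed k i + mixed (suc k) i
    mixed-suc k i = begin
      (k !) * ∑-kSubsets proper k (adjoin Φ ∘ familyCut)
        ≡⟨ cong ((k !) *_) (trans
             (∑-cong (λ F → trans
               (cong (𝟙 (kSubset proper k F) *_) (sym (∑-proper-insert Φ (adjoin^-ext i separates-ext) F)))
               (*-distribˡ-+ (𝟙 (kSubset proper k F)) _ _)) (cube candidates))
             (∑-distrib-+ _ _ (cube candidates))) ⟩
      (k !) * (∑-kSubsets proper k (λ F → ∑ (allFin candidates) (λ t → 𝟙 (proper t) * φ (insert t F)))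
        + ∑-kSubsets proper k φ)
        ≡⟨ cong (λ s → (k !) * (s + ∑-kSubsets proper k φ)) (∑-kSubsets-insert proper k φ) ⟩
      (k !) * (k * ∑-kSubsets proper k φ + suc k * ∑-kSubsets proper (suc k) φ + ∑-kSubsets proper k φ)
        ≡⟨ rearrange k (k !) (∑-kSubsets proper k φ) (∑-kSubsets proper (suc k) φ) ⟩
      suc k * ((k !) * ∑-kSubsets proper k φ) + (suc k * (k !)) * ∑-kSubsets proper (suc k) φ ∎
      where
      open ≡-Reasoning
      Φ = adjoin^ {m} i (𝟙 ∘ separates)
      φ = Φ ∘ familyCut
      rearrange : ∀ k f s t →
        f * (k * s + suc k * t + s) ≡ suc k * (f * s) + (suc k * f) * t
      rearrange = solve-∀

    σ-mixed : ∀ k → (k !) * σ (suc m) k ≡ mixed k 0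
    σ-mixed k = cong ((k !) *_) (begin
      σ (suc m) k
        ≡⟨ countF-∑ (2 ^ candidates) _ ⟩
      ∑ (allFin (2 ^ candidates)) (λ u → 𝟙 (goodFamᵇ {suc m} k (lookup (subsets candidates) u)))
        ≡⟨ ∑-allFin-lookup (λ F → 𝟙 (goodFamᵇ {suc m} k F)) (subsets candidates) ⟩
      ∑ (cube candidates) (λ F → 𝟙 (goodFamᵇ {suc m} k F))
        ≡⟨ ∑-cong (λ F → trans (cong 𝟙 (sym (∧-assoc (within proper F) (size F ≡ᵇ k) (separatingᵇ {suc m} F))))
             (𝟙-∧ (kSubset proper k F) (separatingᵇ {suc m} F))) (cube candidates) ⟩
      ∑-kSubsets proper k (𝟙 ∘ separates ∘ familyCut) ∎)
      where open ≡-Reasoning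

-- Solving the recurrence with signed Stirling numbers

module Recurrence where

  open import Data.Integer using (ℤ; +_; -_)
  open import Data.Nat using (_+_; _*_)

  -- The induction involves the constant coefficient of the polynomial, which `sumFrom1` omits; its
  -- term disappears only in the final specialization.
  sumFrom0 : ℕ → (ℕ → ℤ) → ℤ
  sumFrom0 k f = f 0 ℤ.+ sumFrom1 k f

  sumFrom1-cong : ∀ k {f g : ℕ → ℤ} → (∀ i → f i ≡ g i) → sumFrom1 k f ≡ sumFrom1 k g
  sumFrom1-cong zero    h = refl
  sumFrom1-cong (suc k) h = cong₂ ℤ._+_ (sumFrom1-cong k h) (h (suc k))

  sumFrom1-+ : ∀ k (f g : ℕ → ℤ) → sumFrom1 k (λ i → f i ℤ.+ g i) ≡ sumFrom1 k f ℤ.+ sumFrom1 k g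
  sumFrom1-+ zero    f g = refl
  sumFrom1-+ (suc k) f g =
    trans (cong (ℤ._+ (f (suc k) ℤ.+ g (suc k))) (sumFrom1-+ k f g))
      (interchange (sumFrom1 k f) (sumFrom1 k g) (f (suc k)) (g (suc k)))
    where
    interchange : ∀ a b c d → a ℤ.+ b ℤ.+ (c ℤ.+ d) ≡ a ℤ.+ c ℤ.+ (b ℤ.+ d)
    interchange = ℤ.solve-∀

  *-distribˡ-sumFrom1 : ∀ k c (f : ℕ → ℤ) → sumFrom1 k (λ i → c ℤ.* f i) ≡ c ℤ.* sumFrom1 k f
  *-distribˡ-sumFrom1 zero    c f = sym (ℤ.*-zeroʳ c)
  *-distribˡ-sumFrom1 (suc k) c f =
    trans (cong (ℤ._+ (c ℤ.* f (suc k))) (*-distribˡ-sumFrom1 k c f)) (sym (ℤ.*-distribˡ-+ c _ _))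

  sumFrom0-+ : ∀ k (f g : ℕ → ℤ) → sumFrom0 k (λ i → f i ℤ.+ g i) ≡ sumFrom0 k f ℤ.+ sumFrom0 k g
  sumFrom0-+ k f g =
    trans (cong (λ z → (f 0 ℤ.+ g 0) ℤ.+ z) (sumFrom1-+ k f g))
      (interchange (f 0) (g 0) (sumFrom1 k f) (sumFrom1 k g))
    where
    interchange : ∀ a b c d → a ℤ.+ b ℤ.+ (c ℤ.+ d) ≡ a ℤ.+ c ℤ.+ (b ℤ.+ d)
    interchange = ℤ.solve-∀

  *-distribˡ-sumFrom0 : ∀ k c (f : ℕ → ℤ) → sumFrom0 k (λ i → c ℤ.* f i) ≡ c ℤ.* sumFrom0 k f
  *-distribˡ-sumFrom0 k c f =
    trans (cong (λ z → (c ℤ.* f 0) ℤ.+ z) (*-distribˡ-sumFrom1 k c f)) (sym (ℤ.*-distribˡ-+ c _ _))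

  sumFrom0-suc : ∀ k (f : ℕ → ℤ) → sumFrom0 (suc k) f ≡ f 0 ℤ.+ sumFrom0 k (f ∘ suc)
  sumFrom0-suc k f = cong (λ z → f 0 ℤ.+ z) (shift k)
    where
    shift : ∀ k → sumFrom1 (suc k) f ≡ f 1 ℤ.+ sumFrom1 k (f ∘ suc)
    shift zero    = ℤ.+-comm (+ 0) (f 1)
    shift (suc k) = trans (cong (ℤ._+ f (suc (suc k))) (shift k)) (ℤ.+-assoc (f 1) _ _)

  stirling1-above : ∀ {a b} → a < b → stirling1 a b ≡ 0
  stirling1-above {zero}  (s≤s _)   = refl
  stirling1-above {suc a} (s≤s a<b) =
    cong₂ _+_ (trans (cong (a *_) (stirling1-above (m<n⇒m<1+n a<b))) (*-zeroʳ a)) (stirling1-above a<b)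

  -- The coefficient of x^l in (x - 1)(x - 2)⋯(x - k).
  coefficient : ℕ → ℕ → ℤ
  coefficient k l = signℤ (k ∸ l) ℤ.* + stirling1 (suc k) (suc l)

  coefficient-above : ∀ k → coefficient k (suc k) ≡ + 0
  coefficient-above k =
    trans (cong (λ s → signℤ (k ∸ suc k) ℤ.* + s) (stirling1-above {suc k} ≤-refl)) (ℤ.*-zeroʳ (signℤ (k ∸ suc k)))

  pos-*-+ : ∀ a b c → + (a * b + c) ≡ + a ℤ.* + b ℤ.+ + c
  pos-*-+ a b c = trans (ℤ.pos-+ (a * b) c) (cong (ℤ._+ + c) (ℤ.pos-* a b))

  coefficient-suc-zero : ∀ k → coefficient (suc k) 0 ≡ - (+ suc k) ℤ.* coefficient k 0
  coefficient-suc-zero k =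
    trans (cong (- signℤ k ℤ.*_) (pos-*-+ (suc k) (stirling1 (suc k) 1) 0))
      (rearrange (signℤ k) (+ suc k) (+ stirling1 (suc k) 1))
    where
    rearrange : ∀ s a b → - s ℤ.* (a ℤ.* b ℤ.+ + 0) ≡ - a ℤ.* (s ℤ.* b)
    rearrange = ℤ.solve-∀

  -- Multiplication of the polynomial by `x - (k + 1)`: the Stirling recurrence with signs.
  coefficient-suc-suc : ∀ k l →
    coefficient (suc k) (suc l) ≡ coefficient k l ℤ.+ - (+ suc k) ℤ.* coefficient k (suc l)
  coefficient-suc-suc k l =
    trans (cong (signℤ (k ∸ l) ℤ.*_)
            (pos-*-+ (suc k) (stirling1 (suc k) (suc (suc l))) (stirling1 (suc k) (suc l))))
      (trans (rearrange (signℤ (k ∸ l)) (+ suc k) (+ s) (+ stirling1 (suc k) (suc l)))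
        (cong (λ z → coefficient k l ℤ.+ - (+ suc k) ℤ.* z) flip))
    where
    s = stirling1 (suc k) (suc (suc l))
    rearrange : ∀ t a b c → t ℤ.* (a ℤ.* b ℤ.+ c) ≡ t ℤ.* c ℤ.+ - a ℤ.* (- t ℤ.* b)
    rearrange = ℤ.solve-∀
    -- The two signs are opposite only for `l < k`; beyond that both differences truncate to zero,
    -- but then `s` is zero.
    flip : - signℤ (k ∸ l) ℤ.* + s ≡ signℤ (k ∸ suc l) ℤ.* + s
    flip with l <? k
    ... | yes l<k = cong (ℤ._* + s)
      (trans (cong (-_ ∘ signℤ) (+-∸-assoc 1 l<k)) (ℤ.neg-involutive (signℤ (k ∸ suc l))))
    ... | no l≮k rewrite stirling1-above {suc k} {suc (suc l)} (s≤s (s≤s (≮⇒≥ l≮k))) =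
      trans (ℤ.*-zeroʳ (- signℤ (k ∸ l))) (sym (ℤ.*-zeroʳ (signℤ (k ∸ suc l))))

  -- The linear functional x^i ↦ g i sends x^i (x - 1)⋯(x - k) to h k i.
  solve-recurrence : (g : ℕ → ℕ) (h : ℕ → ℕ → ℕ) → (∀ i → h 0 i ≡ g i) →
    (∀ k i → h k (suc i) ≡ suc k * h k i + h (suc k) i) →
    ∀ k i → + h k i ≡ sumFrom0 k (λ l → coefficient k l ℤ.* + g (i + l))
  solve-recurrence g h h-zero h-suc zero i =
    trans (cong +_ (trans (h-zero i) (cong g (sym (+-identityʳ i))))) (lemma (+ g (i + 0)))
    where
    lemma : ∀ x → x ≡ + 1 ℤ.* x ℤ.+ + 0
    lemma = ℤ.solve-∀
  solve-recurrence g h h-zero h-suc (suc k) i = begin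
    + h (suc k) i
      ≡⟨ subtract (+ suc k ℤ.* + h k i) (+ h (suc k) i) ⟩
    + suc k ℤ.* + h k i ℤ.+ + h (suc k) i ℤ.+ - (+ suc k ℤ.* + h k i)
      ≡⟨ cong (ℤ._+ - (+ suc k ℤ.* + h k i)) (sym (trans (cong +_ (h-suc k i)) (pos-*-+ (suc k) (h k i) _))) ⟩
    + h k (suc i) ℤ.+ - (+ suc k ℤ.* + h k i)
      ≡⟨ cong₂ (λ x y → x ℤ.+ - (+ suc k ℤ.* y)) (ih (suc i)) (ih i) ⟩
    sumFrom0 k up ℤ.+ - (+ suc k ℤ.* sumFrom0 k stay)
      -- The vanishing term `stay (suc k)` is appended, so that after index `0` is split off the
      -- shifted sum has the same range as that of `up`.
      ≡⟨ cong (λ z → sumFrom0 k up ℤ.+ - (+ suc k ℤ.* z)) extend ⟩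
    sumFrom0 k up ℤ.+ - (+ suc k ℤ.* (stay 0 ℤ.+ sumFrom0 k (stay ∘ suc)))
      ≡⟨ regroup (sumFrom0 k up) (+ suc k) (stay 0) (sumFrom0 k (stay ∘ suc)) ⟩
    - (+ suc k) ℤ.* stay 0 ℤ.+ (sumFrom0 k up ℤ.+ - (+ suc k) ℤ.* sumFrom0 k (stay ∘ suc))
      ≡⟨ cong₂ ℤ._+_ first (trans
           (cong (λ z → sumFrom0 k up ℤ.+ z) (sym (*-distribˡ-sumFrom0 k (- (+ suc k)) (stay ∘ suc))))
           (trans (sym (sumFrom0-+ k up _)) (sumFrom0-cong later))) ⟩
    new 0 ℤ.+ sumFrom0 k (new ∘ suc)
      ≡⟨ sym (sumFrom0-suc k new) ⟩
    sumFrom0 (suc k) new ∎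
    where
    open ≡-Reasoning
    up stay new : ℕ → ℤ
    up l   = coefficient k l ℤ.* + g (suc i + l)
    stay l = coefficient k l ℤ.* + g (i + l)
    new l  = coefficient (suc k) l ℤ.* + g (i + l)

    ih = solve-recurrence g h h-zero h-suc k

    sumFrom0-cong : ∀ {f f′ : ℕ → ℤ} → (∀ l → f l ≡ f′ l) → sumFrom0 k f ≡ sumFrom0 k f′
    sumFrom0-cong eq = cong₂ ℤ._+_ (eq 0) (sumFrom1-cong k eq)

    subtract : ∀ a b → b ≡ a ℤ.+ b ℤ.+ - a
    subtract = ℤ.solve-∀

    regroup : ∀ u a s t → u ℤ.+ - (a ℤ.* (s ℤ.+ t)) ≡ - a ℤ.* s ℤ.+ (u ℤ.+ - a ℤ.* t)
    regroup = ℤ.solve-∀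

    extend : sumFrom0 k stay ≡ stay 0 ℤ.+ sumFrom0 k (stay ∘ suc)
    extend = trans (trans (sym (ℤ.+-identityʳ _)) (trans
      (cong (λ z → sumFrom0 k stay ℤ.+ z) (sym (cong (ℤ._* + g (i + suc k)) (coefficient-above k))))
      (ℤ.+-assoc (stay 0) (sumFrom1 k stay) (stay (suc k))))) (sumFrom0-suc k stay)

    first : - (+ suc k) ℤ.* stay 0 ≡ new 0
    first = trans (sym (ℤ.*-assoc (- (+ suc k)) (coefficient k 0) _))
      (cong (ℤ._* + g (i + 0)) (sym (coefficient-suc-zero k)))

    later : ∀ l → up l ℤ.+ - (+ suc k) ℤ.* stay (suc l) ≡ new (suc l)
    later l = trans
      (cong (λ j → coefficient k l ℤ.* + g j ℤ.+ - (+ suc k) ℤ.* stay (suc l)) (sym (+-suc i l)))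
      (trans (factor (coefficient k l) (+ g (i + suc l)) (- (+ suc k)) (coefficient k (suc l)))
        (cong (ℤ._* + g (i + suc l)) (sym (coefficient-suc-suc k l))))
      where
      factor : ∀ a x b c → a ℤ.* x ℤ.+ b ℤ.* (c ℤ.* x) ≡ (a ℤ.+ b ℤ.* c) ℤ.* x
      factor = ℤ.solve-∀

-- The formula for `σ`

open Counting
open Recurrence
open import Data.Integer using (ℤ; +_; _*_)

theorem3p12 : (n k : ℕ) → 2 ≤ n → 1 ≤ k → k < 2 ^ (n ∸ 1) →
    + (k !) * + σ n k
    ≡ + ((n ∸ 1) !) * sumFrom1 k (λ i → signℤ (k ∸ i) * + (stirling1 (k Data.Nat.+ 1) (i Data.Nat.+ 1) Data.Nat.* ((2 ^ i ∸ 1) C (n ∸ 1))))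
theorem3p12 (suc m) k (s≤s 1≤m) _ _ = begin
  + (k !) * + σ (suc m) k
    ≡⟨ sym (ℤ.pos-* (k !) (σ (suc m) k)) ⟩
  + ((k !) ℕ.* σ (suc m) k)
    ≡⟨ cong +_ (σ-mixed m k) ⟩
  + mixed m k 0
    ≡⟨ solve-recurrence g (mixed m) (mixed-zero m) (mixed-suc m) k 0 ⟩
  coefficient k 0 * + g 0 ℤ.+ sumFrom1 k (λ i → coefficient k i * + g i)
    -- The constant term carries `0 C m`, which is zero because `m` is at least 1; hence the sum
    -- starts at index 1.
    ≡⟨ cong₂ ℤ._+_ (trans (cong (λ x → coefficient k 0 * + x) g-zero) (ℤ.*-zeroʳ (coefficient k 0)))
         (trans (sumFrom1-cong k term) (*-distribˡ-sumFrom1 k (+ (m !)) _)) ⟩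
  + 0 ℤ.+ + (m !) * sumFrom1 k _
    ≡⟨ ℤ.+-identityˡ _ ⟩
  + (m !) * sumFrom1 k _ ∎
  where
  open ≡-Reasoning
  g : ℕ → ℕ
  g i = (m !) ℕ.* ((2 ^ i ∸ 1) C m)

  g-zero : g 0 ≡ 0
  g-zero = trans (cong ((m !) ℕ.*_) (k>n⇒nCk≡0 1≤m)) (*-zeroʳ (m !))

  term : ∀ i → coefficient k i * + g i
    ≡ + (m !) * (signℤ (k ∸ i) * + (stirling1 (k ℕ.+ 1) (i ℕ.+ 1) ℕ.* ((2 ^ i ∸ 1) C m)))
  term i rewrite +-comm k 1 | +-comm i 1 = begin
    signℤ (k ∸ i) * + s * + g i
      ≡⟨ cong (signℤ (k ∸ i) * + s *_) (ℤ.pos-* (m !) c) ⟩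
    signℤ (k ∸ i) * + s * (+ (m !) * + c)
      ≡⟨ rearrange (signℤ (k ∸ i)) (+ s) (+ (m !)) (+ c) ⟩
    + (m !) * (signℤ (k ∸ i) * (+ s * + c))
      ≡⟨ cong (λ x → + (m !) * (signℤ (k ∸ i) * x)) (sym (ℤ.pos-* s c)) ⟩
    + (m !) * (signℤ (k ∸ i) * + (s ℕ.* c)) ∎
    where
    s = stirling1 (suc k) (suc i)
    c = (2 ^ i ∸ 1) C m
    rearrange : ∀ a b x y → a * b * (x * y) ≡ x * (a * (b * y))
    rearrange = ℤ.solve-∀
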